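{- Let $H = T \cup C$ be a generalized Halin graph with characteristic tree $T$ and adjoint cycle $C$, and suppose $|C| \neq 5$. Then \[ \mathrm{ch}'_{\mathrm{star}}(H) \leq \max\left\{ \left\lfloor \frac{\theta(T) + \Delta(T)}{2} \right\rfloor,\ 2\left\lfloor \frac{\Delta(T)}{2} \right\rfloor + 7 \right\}, \] where $\theta(T) = \max_{xy \in E(T)} \{ d_T(x) + d_T(y) \}$.
   Context: All graphs are finite and simple. A star $k$-edge coloring of a graph $G$ is a proper edge coloring $\phi: E(G) \to \{1,\dots,k\}$ such that no path or cycle of length four (i.e. with four edges) in $G$ is bichromatic. Given a list assignment $L$ assigning a finite set $L(e)$ to each edge $e$, $G$ is star $k$-edge choosable if for every $L$ with $|L(e)| \geq k$ for all $e$ there is a star edge coloring $\varphi$ with $\varphi(e) \in L(e)$ for all $e$. The list star chromatic index $\mathrm{ch}'_{\mathrm{star}}(G)$ is the minimum such $k$. A generalized Halin graph $H = T \cup C$ is a plane graph consisting of a plane embedding of a tree $T$ (the characteristic tree) with $\Delta(T) \geq 3$ together with a cycle $C$ (the adjoint cycle) connecting all the leaves of $T$ such that $C$ is the boundary of the exterior face. $|C|$ denotes the length of $C$, and $d_T(x)$ the degree of $x$ in $T$. -}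

module Defs where

open import Data.Nat using (ℕ; zero; suc; _+_; _*_; _∸_; _≤_; _⊔_; _≡ᵇ_)
open import Data.Bool using (Bool; true; false; T; _∨_; _∧_; if_then_else_)
open import Data.Fin using (Fin)
open import Data.Fin.Properties using (_≟_)
open import Data.List using (List; []; _∷_; length; map; filterᵇ; foldr; allFin; cartesianProduct; zip; drop; take; _++_)
open import Data.Bool.ListAction using (any)
open import Data.List.Relation.Unary.Linked using (Linked)
open import Data.List.Relation.Unary.Unique.Propositional using (Unique)
open import Data.List.Membership.Propositional using (_∈_)
open import Data.Product using (Σ; ∃; ∃-syntax; _×_; _,_; proj₁; proj₂)
open import Data.Sum using (_⊎_)
open import Relation.Nullary using (¬_; does)
open import Relation.Binary.PropositionalEquality using (_≡_; _≢_)

-- Graphs on vertex set Fin n, given by a Boolean adjacency function.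
-- (Simplicity = symmetric + irreflexive, imposed where needed.)

Graph : ℕ → Set
Graph n = Fin n → Fin n → Bool

module _ {n : ℕ} (G : Graph n) where

  Adj : Fin n → Fin n → Set
  Adj u v = T (G u v)

  Symmetric : Set
  Symmetric = ∀ u v → G u v ≡ G v u

  Irreflexive : Set
  Irreflexive = ∀ u → G u u ≡ false

  deg : Fin n → ℕ
  deg v = length (filterᵇ (G v) (allFin n))

  maxDeg : ℕ
  maxDeg = foldr _⊔_ 0 (map deg (allFin n))

  theta : ℕ
  theta = foldr _⊔_ 0
    (map (λ p → if G (proj₁ p) (proj₂ p) then deg (proj₁ p) + deg (proj₂ p) else 0)
         (cartesianProduct (allFin n) (allFin n)))

  data Walk : Fin n → Fin n → Set where
    here : ∀ {u} → Walk u u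
    step : ∀ {u v w} → Adj u v → Walk v w → Walk u w

  Connected : Set
  Connected = ∀ u v → Walk u v

  IsCycle : List (Fin n) → Set
  IsCycle vs = Unique vs × (3 ≤ length vs) × Linked Adj (vs ++ take 1 vs)

  Acyclic : Set
  Acyclic = ∀ vs → ¬ IsCycle vs

  IsTree : Set
  IsTree = Symmetric × Irreflexive × Connected × Acyclic

  isLeaf : Fin n → Bool
  isLeaf v = deg v ≡ᵇ 1

-- Plane embeddings of a tree, combinatorially: a rotation system
-- (a cyclic order of the neighbours around each vertex).

iter : ∀ {A : Set} → (A → A) → ℕ → A → A
iter f zero x = x
iter f (suc k) x = f (iter f k x)

record RotationSystem {n : ℕ} (G : Graph n) : Set where
  field
    rot    : Fin n → Fin n → Fin n
    closed : ∀ v u → Adj G v u → Adj G v (rot v u)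
    cyclic : ∀ v u w → Adj G v u → Adj G v w → ∃[ k ] iter (rot v) k u ≡ w

open RotationSystem public

faceWalk : ∀ {n} {G : Graph n} → RotationSystem G → ℕ → Fin n → Fin n → List (Fin n × Fin n)
faceWalk R zero u v = []
faceWalk R (suc k) u v = (u , v) ∷ faceWalk R k v (rot R v u)

-- the leaves in the order in which the boundary of the (unique, exterior)
-- face of the embedded tree reaches them, starting from dart (u,v);
-- the walk traverses all 2(n-1) darts of the tree.
leafOrder : ∀ {n} (G : Graph n) → RotationSystem G → Fin n → Fin n → List (Fin n)
leafOrder {n} G R u v =
  map proj₂ (filterᵇ (λ d → isLeaf G (proj₂ d)) (faceWalk R (2 * (n ∸ 1)) u v))

PlaneLeafOrder : ∀ {n} (G : Graph n) → List (Fin n) → Set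
PlaneLeafOrder G cyc =
  Σ (RotationSystem G) λ R → ∃[ u ] ∃[ v ] (Adj G u v × leafOrder G R u v ≡ cyc)

cycAdj : ∀ {n} → List (Fin n) → Graph n
cycAdj cyc u v =
  any (λ p → (does (proj₁ p ≟ u) ∧ does (proj₂ p ≟ v)) ∨ (does (proj₁ p ≟ v) ∧ does (proj₂ p ≟ u)))
      (zip cyc (drop 1 cyc ++ take 1 cyc))

_∪ᴳ_ : ∀ {n} → Graph n → Graph n → Graph n
(G ∪ᴳ H) u v = G u v ∨ H u v

record GenHalin (n : ℕ) : Set where
  field
    tree     : Graph n
    isTree   : IsTree tree
    Δ≥3      : 3 ≤ maxDeg tree
    cyc      : List (Fin n)
    embedded : PlaneLeafOrder tree cyc

  graph : Graph n
  graph = tree ∪ᴳ cycAdj cyc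

open GenHalin public

-- Star edge colourings and list star chromatic index.
-- An edge colouring is φ : Fin n → Fin n → ℕ, required to be symmetric on edges.

module _ {n : ℕ} (G : Graph n) where

  SymOnEdges : ∀ {A : Set} → (Fin n → Fin n → A) → Set
  SymOnEdges φ = ∀ u v → Adj G u v → φ u v ≡ φ v u

  Proper : (Fin n → Fin n → ℕ) → Set
  Proper φ = ∀ u v w → Adj G u v → Adj G v w → u ≢ w → φ u v ≢ φ v w

  Bichromatic : ℕ → ℕ → ℕ → ℕ → Set
  Bichromatic a b c d = ∃[ x ] ∃[ y ] (In x y a × In x y b × In x y c × In x y d)
    where
    In : ℕ → ℕ → ℕ → Set
    In x y z = z ≡ x ⊎ z ≡ y

  NoBichromaticPath4 : (Fin n → Fin n → ℕ) → Set
  NoBichromaticPath4 φ = ∀ v0 v1 v2 v3 v4 →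
    Unique (v0 ∷ v1 ∷ v2 ∷ v3 ∷ v4 ∷ []) →
    Adj G v0 v1 → Adj G v1 v2 → Adj G v2 v3 → Adj G v3 v4 →
    ¬ Bichromatic (φ v0 v1) (φ v1 v2) (φ v2 v3) (φ v3 v4)

  NoBichromaticCycle4 : (Fin n → Fin n → ℕ) → Set
  NoBichromaticCycle4 φ = ∀ v0 v1 v2 v3 →
    Unique (v0 ∷ v1 ∷ v2 ∷ v3 ∷ []) →
    Adj G v0 v1 → Adj G v1 v2 → Adj G v2 v3 → Adj G v3 v0 →
    ¬ Bichromatic (φ v0 v1) (φ v1 v2) (φ v2 v3) (φ v3 v0)

  IsStarEdgeColoring : (Fin n → Fin n → ℕ) → Set
  IsStarEdgeColoring φ =
    SymOnEdges φ × Proper φ × NoBichromaticPath4 φ × NoBichromaticCycle4 φ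

  -- list assignment with every list of size ≥ k (lists are duplicate-free,
  -- i.e. represent finite sets of colours)
  ValidListAssignment : ℕ → (Fin n → Fin n → List ℕ) → Set
  ValidListAssignment k L =
    SymOnEdges L × (∀ u v → Adj G u v → Unique (L u v) × k ≤ length (L u v))

  StarChoosable : ℕ → Set
  StarChoosable k = ∀ L → ValidListAssignment k L →
    ∃[ φ ] (IsStarEdgeColoring φ × (∀ u v → Adj G u v → φ u v ∈ L u v))

  -- ch'_star(G) ≤ m  (ch'_star is the least k with G star k-edge choosable)
  ListStarChromaticIndex≤ : ℕ → Set
  ListStarChromaticIndex≤ m = ∃[ k ] (k ≤ m × StarChoosable k)

{-# OPTIONS --safe #-}
-- Root the tree at a vertex of degree at least 3.  A bichromatic 4-path or 4-cycle with middle vertex u and inner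
-- neighbours x, y needs the colour of uy at x and the colour of ux at y.  So put the neighbours of u in a cyclic order
-- and let out u x be the ⌊ deg u / 2 ⌋ of them following x: one of x, y is in the list of the other, and it is enough
-- that the colours of the edges uy with y in out u x do not occur at x.
--
-- Colour the tree edges greedily by depth, siblings in the order that also underlies the cyclic lists.  The i-th edge at
-- u ≠ root avoids its i predecessors at u, and then either (i ≤ ⌊ deg u / 2 ⌋) the other edges at par u or otherwise the
-- ⌊ deg (par u) / 2 ⌋ edges from par u to out (par u) u; in both cases these are fewer than
-- ⌊ (θ + Δ) / 2 ⌋ colours.
--
-- Walking around the tree, two consecutive leaves with different parents are such that one of them is the first or the
-- last child of its parent in the rotation.  Such special children come first among their siblings, so they have room
-- to avoid the colours of the edges at the two neighbouring leaves as well.  Finally a cycle edge avoids two lists of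
-- ⌊ Δ / 2 ⌋ colours and four edges at leaves, which leaves 3 colours for the star edge colouring of a cycle of length ≠ 5.
module Submission where

open import Defs
open import Data.Bool using (Bool; true; false; T; not; _∨_; _∧_; if_then_else_)
open import Data.Bool.ListAction using (any)
open import Data.Bool.Properties using (T-∨; T-∧; ∨-comm; not-injective)
open import Data.Empty using (⊥; ⊥-elim)
open import Data.Fin using (Fin; toℕ)
open import Data.Fin.Properties using (_≟_; toℕ-injective; toℕ<n)
open import Data.List using (List; []; _∷_; length; map; filter; filterᵇ; foldr; allFin; cartesianProduct; zip; drop; take; _++_; upTo)
open import Data.List.Membership.DecPropositional using () renaming (_∈?_ to mem?)
open import Data.List.Membership.Propositional using (_∈_; _∉_)
open import Data.List.Membership.Propositional.Properties using (∈-++⁺ˡ; ∈-++⁺ʳ; ∈-++⁻; ∈-filter⁺; ∈-filter⁻; ∈-map⁺; ∈-map⁻; ∈-allFin; ∈-∃++; ∈-cartesianProduct⁺; ∈-upTo⁺)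
open import Data.List.Properties using (length-++; length-map; length-filter; filter-notAll; map-cong-local; length-tabulate; length-upTo)
open import Data.List.Relation.Unary.All as All using (All; []; _∷_)
open import Data.List.Relation.Unary.AllPairs using ([]; _∷_)
open import Data.List.Relation.Unary.Any using (Any; here; there)
open import Data.List.Relation.Unary.Linked using (Linked; []; [-]; _∷_)
open import Data.List.Relation.Unary.Unique.Propositional using (Unique)
import Data.List.Relation.Unary.Unique.Propositional.Properties as Uniq
open import Data.Nat using (ℕ; zero; suc; _+_; _*_; _∸_; _≤_; _<_; _⊔_; z≤n; s≤s; ⌊_/2⌋; _≤?_; _<?_)
import Data.Nat.Properties as ℕₚ
open import Data.Product using (Σ; ∃-syntax; _×_; _,_; proj₁; proj₂)
open import Data.Product.Properties using (≡-dec)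
open import Data.Sum using (_⊎_; inj₁; inj₂; [_,_]′)
open import Data.Unit using (tt)
open import Function using (_∘_; id)
open import Function.Bundles using (Equivalence)
open import Relation.Binary.Definitions using (tri<; tri≈; tri>)
open import Relation.Binary.PropositionalEquality using (_≡_; _≢_; refl; sym; trans; cong; cong₂; subst; ≢-sym)
open import Relation.Nullary using (¬_; Dec; yes; no; does)
open import Relation.Nullary.Decidable using (T?; ¬?; _×-dec_; _⊎-dec_; dec-true)

-- The embedding is given only by a rotation at each vertex, while `leafOrder` takes 2 (n - 1) steps
-- of the face walk from an arbitrary dart. That these steps form one closed round through all darts
-- is special to trees and has to be proved before consecutive leaves can be compared; injectivity
-- of the rotations has to be derived as well. The degree of the root makes it an inner vertex and
-- supplies three leaves, so that C has length at least 3. Both terms of the bound are what greedy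
-- colouring needs. For a tree edge, 2 (⌊ d(u) / 2 ⌋ + d(w)) ≤ (d(u) + d(w)) + d(w) ≤ θ + Δ. A cycle
-- edge has at most 2 ⌊ Δ / 2 ⌋ + 4 + 2 forbidden colours, whence the 7. The same 7 serves a special
-- child: at most 3 earlier edges at its parent, Δ above it and 2 at leaves are fewer than Δ + 6 ≤ 2
-- ⌊ Δ / 2 ⌋ + 7. Length 5 is excluded because three colours do not suffice for it: in a proper
-- 3-edge colouring of a 5-cycle one colour occurs once, and the other four edges form a bichromatic
-- path.

∈-tail : {A : Set} {x y : A} {xs : List A} → y ∈ x ∷ xs → y ≢ x → y ∈ xs
∈-tail (here y≡x) y≢x = ⊥-elim (y≢x y≡x)
∈-tail (there y∈) _   = y∈

unique-⊆-length : {A : Set} {xs ys : List A} → Unique xs → (∀ {x} → x ∈ xs → x ∈ ys) →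
                  length xs ≤ length ys
unique-⊆-length {xs = []} _ _ = z≤n
unique-⊆-length {xs = x ∷ xs} (x≢ ∷ uniq) sub with ∈-∃++ (sub (here refl))
... | as , bs , refl = begin
    suc (length xs)            ≤⟨ s≤s (unique-⊆-length uniq sub′) ⟩
    suc (length (as ++ bs))    ≡⟨ cong suc (length-++ as) ⟩
    suc (length as + length bs) ≡⟨ ℕₚ.+-suc (length as) (length bs) ⟨
    length as + suc (length bs) ≡⟨ length-++ as ⟨
    length (as ++ x ∷ bs)      ∎
  where
  open ℕₚ.≤-Reasoning
  sub′ : ∀ {y} → y ∈ xs → y ∈ as ++ bs
  sub′ y∈ with ∈-++⁻ as (sub (there y∈))
  ... | inj₁ y∈as = ∈-++⁺ˡ y∈as
  ... | inj₂ y∈x∷bs = ∈-++⁺ʳ as (∈-tail y∈x∷bs λ y≡x → All.lookup x≢ y∈ (sym y≡x))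

unique-map : {A B : Set} {f : A → B} {xs : List A} →
             (∀ {x y} → x ∈ xs → y ∈ xs → f x ≡ f y → x ≡ y) → Unique xs → Unique (map f xs)
unique-map {xs = []} _ _ = []
unique-map {f = f} {xs = x ∷ xs} inj (x≢ ∷ uniq) =
  All.tabulate (λ {z} z∈ fx≡z → let y , y∈ , z≡fy = ∈-map⁻ f z∈ in
    All.lookup x≢ y∈ (inj (here refl) (there y∈) (trans fx≡z z≡fy)))
  ∷ unique-map (λ p q → inj (there p) (there q)) uniq

-- Greedy list colouring

infix 4 _∈ℕ?_
_∈ℕ?_ : (x : ℕ) (xs : List ℕ) → Dec (x ∈ xs)
_∈ℕ?_ = mem? ℕₚ._≟_

pick : List ℕ → List ℕ → ℕ
pick []       ys = 0
pick (x ∷ xs) ys with x ∈ℕ? ys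
... | yes _ = pick xs ys
... | no  _ = x

pick-or-⊆ : ∀ xs ys → (pick xs ys ∈ xs × pick xs ys ∉ ys) ⊎ (∀ {x} → x ∈ xs → x ∈ ys)
pick-or-⊆ [] ys = inj₂ λ ()
pick-or-⊆ (x ∷ xs) ys with x ∈ℕ? ys
... | no x∉ = inj₁ (here refl , x∉)
... | yes x∈ with pick-or-⊆ xs ys
...   | inj₁ (p , q) = inj₁ (there p , q)
...   | inj₂ sub     = inj₂ λ { (here refl) → x∈ ; (there z∈) → sub z∈ }

pick-spec : ∀ {xs ys} → Unique xs → length ys < length xs → pick xs ys ∈ xs × pick xs ys ∉ ys
pick-spec {xs} {ys} uniq lt with pick-or-⊆ xs ys
... | inj₁ p   = p
... | inj₂ sub = ⊥-elim (ℕₚ.<⇒≱ lt (unique-⊆-length uniq sub))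

-- Used twice, for the tree edges and for the cycle edges. A conflict is respected by the item of
-- larger rank, which has to list the other one in `conf`; `avoid` holds colours fixed beforehand.
module Greedy {I : Set} (rank : I → ℕ) (conf : I → List I) (avoid : I → List ℕ) (L : I → List ℕ)
  (uniq : ∀ i → Unique (L i))
  (enough : ∀ i → length (avoid i) + length (filter (λ j → rank j <? rank i) (conf i)) < length (L i))
  where

  earlier : I → List I
  earlier i = filter (λ j → rank j <? rank i) (conf i)

  forbidden : (I → ℕ) → I → List ℕ
  forbidden c i = avoid i ++ map c (earlier i)

  -- the first argument is fuel, enough as soon as it exceeds the rank
  colourUpTo : ℕ → I → ℕ
  colourUpTo zero    i = 0
  colourUpTo (suc k) i = pick (L i) (forbidden (colourUpTo k) i)

  colour : I → ℕ
  colour i = colourUpTo (suc (rank i)) i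

  fuel-irrelevant : ∀ k k′ i → rank i < k → rank i < k′ → colourUpTo k i ≡ colourUpTo k′ i
  fuel-irrelevant (suc k) (suc k′) i (s≤s p) (s≤s p′) =
    cong (λ cs → pick (L i) (avoid i ++ cs)) (map-cong-local (All.tabulate λ {j} j∈ →
      let j<i = proj₂ (∈-filter⁻ (λ j → rank j <? rank i) {xs = conf i} j∈) in
      fuel-irrelevant k k′ j (ℕₚ.<-≤-trans j<i p) (ℕₚ.<-≤-trans j<i p′)))

  spec : ∀ i → colour i ∈ L i × colour i ∉ forbidden (colourUpTo (rank i)) i
  spec i = pick-spec (uniq i) (subst (_< length (L i)) (sym eq) (enough i))
    where
    eq : length (forbidden (colourUpTo (rank i)) i) ≡ length (avoid i) + length (earlier i)
    eq = trans (length-++ (avoid i)) (cong (length (avoid i) +_) (length-map _ (earlier i)))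

  colour∈ : ∀ i → colour i ∈ L i
  colour∈ i = proj₁ (spec i)

  colour-avoids : ∀ i {x} → x ∈ avoid i → colour i ≢ x
  colour-avoids i x∈ refl = proj₂ (spec i) (∈-++⁺ˡ x∈)

  colour-differs : ∀ i j → j ∈ conf i → rank j < rank i → colour i ≢ colour j
  colour-differs i j j∈ j<i eq = proj₂ (spec i) (∈-++⁺ʳ (avoid i)
    (subst (_∈ map (colourUpTo (rank i)) (earlier i))
       (trans (fuel-irrelevant (rank i) (suc (rank j)) j j<i ℕₚ.≤-refl) (sym eq))
       (∈-map⁺ (colourUpTo (rank i)) (∈-filter⁺ (λ j → rank j <? rank i) j∈ j<i))))

  colouring : ∃[ c ] ((∀ i → c i ∈ L i) × (∀ i {x} → x ∈ avoid i → c i ≢ x) ×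
                      (∀ i j → j ∈ conf i → rank j < rank i → c i ≢ c j))
  colouring = colour , colour∈ , colour-avoids , colour-differs

-- Rooted trees: unique reduced paths to the root

record Rooting {n : ℕ} (G : Graph n) (r : Fin n) : Set where
  field
    par        : Fin n → Fin n
    depth      : Fin n → ℕ
    depth-root : depth r ≡ 0
    par-adj    : ∀ {v} → v ≢ r → Adj G v (par v)
    par-depth  : ∀ {v} → v ≢ r → depth v ≡ suc (depth (par v))
    edge-par   : ∀ {x y} → Adj G x y → (y ≢ r × x ≡ par y) ⊎ (x ≢ r × y ≡ par x)

unique-prefix : {A : Set} (ys : List A) {x : A} {zs : List A} → Unique (ys ++ x ∷ zs) → Unique (x ∷ ys)
unique-prefix [] _ = [] ∷ []
unique-prefix (y ∷ ys) {x} (y≢ ∷ uniq) with unique-prefix ys uniq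
... | x≢ ∷ uniq′ = (≢-sym (All.lookup y≢ (∈-++⁺ʳ ys (here refl))) ∷ x≢)
                 ∷ (All.tabulate (λ z∈ → All.lookup y≢ (∈-++⁺ˡ z∈)) ∷ uniq′)

linked-prefix : {A : Set} {R : A → A → Set} (as : List A) {b : A} {bs : List A} →
                Linked R (as ++ b ∷ bs) → Linked R (as ++ b ∷ [])
linked-prefix []           _        = [-]
linked-prefix (a ∷ [])     (p ∷ _)  = p ∷ [-]
linked-prefix (a ∷ c ∷ as) (p ∷ ps) = p ∷ linked-prefix (c ∷ as) ps

module TreeRooting {n : ℕ} (G : Graph n) (isTree : IsTree G) (r : Fin n) where

  private
    adj-sym : ∀ {u v} → Adj G u v → Adj G v u
    adj-sym {u} {v} = subst T (proj₁ isTree u v)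

    loopless : ∀ {u} → ¬ Adj G u u
    loopless {u} = subst T (proj₁ (proj₂ isTree) u)

    acyclic : Acyclic G
    acyclic = proj₂ (proj₂ (proj₂ isTree))

  data Reduced : List (Fin n) → Set where
    one  : ∀ {x} → Reduced (x ∷ [])
    two  : ∀ {x y} → Adj G x y → Reduced (x ∷ y ∷ [])
    more : ∀ {x y z xs} → Adj G x y → x ≢ z → Reduced (y ∷ z ∷ xs) → Reduced (x ∷ y ∷ z ∷ xs)

  reduced-linked : ∀ {xs} → Reduced xs → Linked (Adj G) xs
  reduced-linked one          = [-]
  reduced-linked (two a)      = a ∷ [-]
  reduced-linked (more a _ p) = a ∷ reduced-linked p

  reduced-tail : ∀ {x y xs} → Reduced (x ∷ y ∷ xs) → Reduced (y ∷ xs)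
  reduced-tail (two _)      = one
  reduced-tail (more _ _ p) = p

  reduced-adj : ∀ {x y xs} → Reduced (x ∷ y ∷ xs) → Adj G x y
  reduced-adj (two a)      = a
  reduced-adj (more a _ _) = a

  -- the first return of the walk to x would close up a cycle
  no-return : ∀ {x} xs → Reduced (x ∷ xs) → Unique xs → x ∉ xs
  no-return {x} xs red uniq x∈ with ∈-∃++ x∈
  no-return {x} _ red uniq x∈ | [] , zs , refl = loopless (reduced-adj red)
  no-return {x} _ (more _ x≢x _) uniq x∈ | y ∷ [] , zs , refl = x≢x refl
  no-return {x} _ red uniq x∈ | ys@(_ ∷ _ ∷ _) , zs , refl =
    acyclic (x ∷ ys) (unique-prefix ys uniq , s≤s (s≤s (s≤s z≤n)) , linked-prefix (x ∷ ys) (reduced-linked red))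

  unique-∷ : ∀ {x xs} → Reduced (x ∷ xs) → Unique xs → Unique (x ∷ xs)
  unique-∷ {xs = xs} red uniq =
    All.tabulate (λ z∈ x≡z → no-return _ red uniq (subst (_∈ xs) (sym x≡z) z∈)) ∷ uniq

  reduced-unique : ∀ {xs} → Reduced xs → Unique xs
  reduced-unique one              = [] ∷ []
  reduced-unique red@(two _)      = unique-∷ red ([] ∷ [])
  reduced-unique red@(more _ _ p) = unique-∷ red (reduced-unique p)

  Ends : Fin n → List (Fin n) → Set
  Ends v []       = v ≡ r
  Ends v (x ∷ xs) = Ends x xs

  ends-∈ : ∀ v xs → Ends v xs → r ∈ v ∷ xs
  ends-∈ v []       v≡r = here (sym v≡r)
  ends-∈ v (x ∷ xs) e   = there (ends-∈ x xs e)

  Path : Fin n → List (Fin n) → Set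
  Path v xs = Reduced (v ∷ xs) × Ends v xs

  -- A step that would backtrack cancels against the first step of the path instead of being
  -- prepended.
  walk-path : ∀ {v} → Walk G v r → ∃[ xs ] Path v xs
  walk-path here = [] , one , refl
  walk-path (step {u} {v} a w) with walk-path w
  ... | []     , _   , e = v ∷ [] , two a , e
  ... | y ∷ ys , red , e with u ≟ y
  ...   | yes refl = ys , reduced-tail red , e
  ...   | no u≢y   = v ∷ y ∷ ys , more a u≢y red , e

  -- two paths to r that part at v: running back along one of them and then along the other never backtracks
  no-fork : ∀ xs x v ys → Reduced (x ∷ v ∷ ys) → Reduced (v ∷ x ∷ xs) → Ends x xs → r ∈ v ∷ ys → ⊥
  no-fork [] x v ys red _ refl r∈ with reduced-unique red
  ... | r≢ ∷ _ = All.lookup r≢ r∈ refl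
  no-fork (z ∷ xs) x v ys red (more _ v≢z red′) e r∈ =
    no-fork xs z x (v ∷ ys) (more (adj-sym (reduced-adj red′)) (≢-sym v≢z) red) red′ e (there r∈)

  not-at-root : ∀ {y ys} → ¬ Path r (y ∷ ys)
  not-at-root {y} {ys} (red , e) with reduced-unique red
  ... | r≢ ∷ _ = All.lookup r≢ (ends-∈ y ys e) refl

  path-unique : ∀ v xs ys → Path v xs → Path v ys → xs ≡ ys
  path-unique v []       []       _          _          = refl
  path-unique v []       (y ∷ ys) (_ , refl) q          = ⊥-elim (not-at-root q)
  path-unique v (x ∷ xs) []       p          (_ , refl) = ⊥-elim (not-at-root p)
  path-unique v (x ∷ xs) (y ∷ ys) (p , e) (q , f) with x ≟ y
  ... | yes refl = cong (x ∷_) (path-unique x xs ys (reduced-tail p , e) (reduced-tail q , f))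
  ... | no x≢y   = ⊥-elim (no-fork xs x v (y ∷ ys) (more (adj-sym (reduced-adj p)) x≢y q) p e (ends-∈ v (y ∷ ys) f))

  toRoot : ∀ v → ∃[ xs ] Path v xs
  toRoot v = walk-path (proj₁ (proj₂ (proj₂ isTree)) v r)

  private
    headOr : List (Fin n) → Fin n
    headOr []      = r
    headOr (x ∷ _) = x

    par : Fin n → Fin n
    par v = headOr (proj₁ (toRoot v))

    depth : Fin n → ℕ
    depth v = length (proj₁ (toRoot v))

    depth-root : depth r ≡ 0
    depth-root with toRoot r
    ... | []     , _ = refl
    ... | x ∷ xs , p = ⊥-elim (not-at-root p)

    par-adj : ∀ {v} → v ≢ r → Adj G v (par v)
    par-adj {v} v≢r with toRoot v
    ... | []     , _ , e = ⊥-elim (v≢r e)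
    ... | x ∷ xs , p , _ = reduced-adj p

    par-depth : ∀ {v} → v ≢ r → depth v ≡ suc (depth (par v))
    par-depth {v} v≢r with toRoot v
    ... | []     , _ , e = ⊥-elim (v≢r e)
    ... | x ∷ xs , p , e = cong suc (cong length (path-unique x xs _ (reduced-tail p , e) (proj₂ (toRoot x))))

    par-of : ∀ {v x xs} → Path v (x ∷ xs) → v ≢ r × x ≡ par v
    par-of {v} {x} {xs} p = (λ { refl → not-at-root p }) , cong headOr (path-unique v (x ∷ xs) _ p (proj₂ (toRoot v)))

    -- If x is not the second vertex of the path from y, putting x in front keeps that path reduced,
    -- so by uniqueness it is the path from x.
    edge-par : ∀ {x y} → Adj G x y → (y ≢ r × x ≡ par y) ⊎ (x ≢ r × y ≡ par x)
    edge-par {x} {y} a with toRoot y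
    ... | []     , p , e = inj₂ (par-of (two a , e))
    ... | z ∷ zs , p , e with x ≟ z
    ...   | yes refl = inj₁ (par-of (p , e) .proj₁ , refl)
    ...   | no x≢z   = inj₂ (par-of (more a x≢z p , e))

  rooting : Rooting G r
  rooting = record
    { par = par ; depth = depth ; depth-root = depth-root
    ; par-adj = par-adj ; par-depth = par-depth ; edge-par = edge-par }

-- Iterates, orbits and single cycles

module _ {A : Set} (f : A → A) where

  iter-suc : ∀ k x → iter f k (f x) ≡ f (iter f k x)
  iter-suc zero    x = refl
  iter-suc (suc k) x = cong f (iter-suc k x)

  iter-+ : ∀ j k x → iter f (j + k) x ≡ iter f j (iter f k x)
  iter-+ zero    k x = refl
  iter-+ (suc j) k x = cong f (iter-+ j k x)

  -- if k < j then f^j z = f^(j-k-1) z because f^(k+1) z = z, so the larger exponent decreases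
  same-image : ∀ b k j {x y z} → k + j < b → f x ≡ z → f y ≡ z → iter f k z ≡ x → iter f j z ≡ y → x ≡ y
  same-image (suc b) k j {x} {y} {z} (s≤s k+j≤b) fx fy kz jz with ℕₚ.<-cmp k j
  ... | tri≈ _ refl _ = trans (sym kz) jz
  ... | tri< k<j _ _  = same-image b k (j ∸ suc k) bound fx fy kz
          (trans (sym (cong (iter f (j ∸ suc k)) (trans (cong f kz) fx)))
            (trans (sym (iter-+ (j ∸ suc k) (suc k) z)) (trans (cong (λ i → iter f i z) (ℕₚ.m∸n+n≡m k<j)) jz)))
    where
    bound : k + (j ∸ suc k) < b
    bound = ℕₚ.<-≤-trans (ℕₚ.+-monoʳ-< k (ℕₚ.∸-monoʳ-< (s≤s z≤n) k<j)) k+j≤b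
  ... | tri> _ _ j<k  = same-image b (k ∸ suc j) j bound fx fy
          (trans (sym (cong (iter f (k ∸ suc j)) (trans (cong f jz) fy)))
            (trans (sym (iter-+ (k ∸ suc j) (suc j) z)) (trans (cong (λ i → iter f i z) (ℕₚ.m∸n+n≡m j<k)) kz))) jz
    where
    bound : k ∸ suc j + j < b
    bound = ℕₚ.<-≤-trans (ℕₚ.+-monoˡ-< j (ℕₚ.∸-monoʳ-< (s≤s z≤n) j<k)) k+j≤b

  orbit : ℕ → A → List A
  orbit zero    x = []
  orbit (suc k) x = x ∷ orbit k (f x)

  length-orbit : ∀ k x → length (orbit k x) ≡ k
  length-orbit zero    x = refl
  length-orbit (suc k) x = cong suc (length-orbit k (f x))

  ∈-orbit⁺ : ∀ {k i} x → i < k → iter f i x ∈ orbit k x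
  ∈-orbit⁺ {suc k} {zero}  x _         = here refl
  ∈-orbit⁺ {suc k} {suc i} x (s≤s i<k) = there (subst (_∈ orbit k (f x)) (iter-suc i x) (∈-orbit⁺ (f x) i<k))

  ∈-orbit⁻ : ∀ {k y} x → y ∈ orbit k x → ∃[ i ] (i < k × y ≡ iter f i x)
  ∈-orbit⁻ {suc k} x (here y≡x) = 0 , s≤s z≤n , y≡x
  ∈-orbit⁻ {suc k} x (there y∈) with ∈-orbit⁻ (f x) y∈
  ... | i , i<k , eq = suc i , s≤s i<k , trans eq (iter-suc i x)

  unique-orbit : ∀ k x → (∀ {i j} → i < j → j < k → iter f i x ≢ iter f j x) → Unique (orbit k x)
  unique-orbit zero    x _    = []
  unique-orbit (suc k) x dist =
    All.tabulate (λ y∈ x≡y → let i , i<k , eq = ∈-orbit⁻ (f x) y∈ in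
      dist (s≤s z≤n) (s≤s i<k) (trans x≡y (trans eq (iter-suc i x))))
    ∷ unique-orbit k (f x) (λ {i} {j} i<j j<k eq →
        dist (s≤s i<j) (s≤s j<k) (trans (sym (iter-suc i x)) (trans eq (iter-suc j x))))

  Reach : A → A → Set
  Reach x y = ∃[ k ] iter f k x ≡ y

  reach-refl : ∀ {x} → Reach x x
  reach-refl = 0 , refl

  reach-trans : ∀ {x y z} → Reach x y → Reach y z → Reach x z
  reach-trans {x} (k , refl) (j , refl) = j + k , iter-+ j k x

  reach-step : ∀ {x y} → Reach x y → Reach x (f y)
  reach-step (k , eq) = suc k , cong f eq

  -- Whole periods are taken off k until it drops below p; b bounds the recursion.
  reach-within : ∀ p {x} → 0 < p → iter f p x ≡ x → ∀ b k → k < b → ∃[ i ] (i < p × iter f k x ≡ iter f i x)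
  reach-within p {x} 0<p period (suc b) k (s≤s k≤b) with k <? p
  ... | yes k<p = k , k<p , refl
  ... | no k≮p with reach-within p 0<p period b (k ∸ p) (ℕₚ.<-≤-trans (ℕₚ.∸-monoʳ-< 0<p (ℕₚ.≮⇒≥ k≮p)) k≤b)
  ...   | i , i<p , eq = i , i<p ,
            trans (cong (λ m → iter f m x) (sym (ℕₚ.m∸n+n≡m (ℕₚ.≮⇒≥ k≮p))))
              (trans (iter-+ (k ∸ p) p x) (trans (cong (iter f (k ∸ p)) period) eq))

-- a permutation of the finite set listed by D is a single cycle if one element reaches everything
module SingleOrbit {A : Set} (f : A → A) (D : List A) (unique-D : Unique D)
  (_≟ᴬ_ : (x y : A) → Dec (x ≡ y)) (closedD : ∀ {x} → x ∈ D → f x ∈ D)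
  (inj : ∀ {x y} → x ∈ D → y ∈ D → f x ≡ f y → x ≡ y)
  where

  iter-∈ : ∀ k {x} → x ∈ D → iter f k x ∈ D
  iter-∈ zero    x∈ = x∈
  iter-∈ (suc k) x∈ = closedD (iter-∈ k x∈)

  iter-injective : ∀ k {x y} → x ∈ D → y ∈ D → iter f k x ≡ iter f k y → x ≡ y
  iter-injective zero    _  _  eq = eq
  iter-injective (suc k) x∈ y∈ eq = iter-injective k x∈ y∈ (inj (iter-∈ k x∈) (iter-∈ k y∈) eq)

  module From {d : A} (d∈ : d ∈ D) (reach : ∀ {x} → x ∈ D → Reach f d x) where

    N : ℕ
    N = length D

    -- A shorter period p would leave at most p values for all N elements of D.
    no-short-period : ∀ p → 0 < p → p < N → iter f p d ≢ d
    no-short-period p 0<p p<N period = ℕₚ.<⇒≱ p<N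
      (subst (N ≤_) (length-orbit f p d) (unique-⊆-length unique-D λ x∈ →
        let k , eq = reach x∈ ; i , i<p , eq′ = reach-within f p 0<p period (suc k) k ℕₚ.≤-refl in
        subst (_∈ orbit f p d) (trans (sym eq′) eq) (∈-orbit⁺ f d i<p)))

    gap : ∀ {i j} → i < j → iter f i d ≡ iter f j d → iter f (j ∸ i) d ≡ d
    gap {i} {j} i<j eq = sym (iter-injective i d∈ (iter-∈ (j ∸ i) d∈)
      (trans eq (trans (cong (λ m → iter f m d) (sym (ℕₚ.m+[n∸m]≡n (ℕₚ.<⇒≤ i<j)))) (iter-+ f i (j ∸ i) d))))

    unique : Unique (orbit f N d)
    unique = unique-orbit f N d λ {i} {j} i<j j<N eq →
      no-short-period (j ∸ i) (ℕₚ.m<n⇒0<n∸m i<j) (ℕₚ.≤-<-trans (ℕₚ.m∸n≤m j i) j<N) (gap i<j eq)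

    covers : ∀ {x} → x ∈ D → x ∈ orbit f N d
    covers {x} x∈ with mem? _≟ᴬ_ x (orbit f N d)
    ... | yes x∈orbit = x∈orbit
    ... | no x∉ = ⊥-elim (ℕₚ.<-irrefl refl (subst (_≤ N) (cong suc (length-orbit f N d))
      (unique-⊆-length (All.tabulate (λ y∈ x≡y → x∉ (subst (_∈ _) (sym x≡y) y∈)) ∷ unique)
        λ { (here refl) → x∈ ; (there y∈) → let i , _ , eq = ∈-orbit⁻ f d y∈ in subst (_∈ D) (sym eq) (iter-∈ i d∈) })))

    -- The N-th iterate occurs in the orbit, say at index i; a positive i would give the period N -
    -- i, which is too short.
    period : iter f N d ≡ d
    period with ∈-orbit⁻ f d (covers (iter-∈ N d∈))
    ... | zero  , _   , eq = eq
    ... | suc i , i<N , eq =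
      ⊥-elim (no-short-period (N ∸ suc i) (ℕₚ.m<n⇒0<n∸m i<N) (ℕₚ.∸-monoʳ-< (s≤s z≤n) (ℕₚ.<⇒≤ i<N)) (gap i<N (sym eq)))

    reach-back : ∀ {x} → x ∈ D → Reach f x d
    reach-back x∈ with ∈-orbit⁻ f d (covers x∈)
    ... | i , i<N , refl = N ∸ i ,
      trans (sym (iter-+ f (N ∸ i) i d)) (trans (cong (λ m → iter f m d) (ℕₚ.m∸n+n≡m (ℕₚ.<⇒≤ i<N))) period)

-- Rotation systems and the face walk of a tree

module RotationLemmas {n : ℕ} {G : Graph n} (R : RotationSystem G) where

  -- By cyclicity both u and w are iterates of their common image, which is the situation of
  -- `same-image`.
  rot-injective : ∀ {v u w} → Adj G v u → Adj G v w → rot R v u ≡ rot R v w → u ≡ w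
  rot-injective {v} {u} {w} au aw eq with cyclic R v (rot R v u) u (closed R v u au) au
                                        | cyclic R v (rot R v u) w (closed R v u au) aw
  ... | k , p | j , q = same-image (rot R v) (suc (k + j)) k j ℕₚ.≤-refl refl (sym eq) p q

  iter-adj : ∀ {v u} k → Adj G v u → Adj G v (iter (rot R v) k u)
  iter-adj         zero    a = a
  iter-adj {v} {u} (suc k) a = closed R v _ (iter-adj k a)

  face : Fin n × Fin n → Fin n × Fin n
  face (u , v) = v , rot R v u

  faceWalk-orbit : ∀ k u v → faceWalk R k u v ≡ orbit face k (u , v)
  faceWalk-orbit zero    u v = refl
  faceWalk-orbit (suc k) u v = cong ((u , v) ∷_) (faceWalk-orbit k v (rot R v u))

module TreeFace {n : ℕ} {G : Graph n} (isTree : IsTree G) {r : Fin n} (rooting : Rooting G r) (R : RotationSystem G) where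
  open Rooting rooting
  open RotationLemmas R

  adj-sym : ∀ {u v} → Adj G u v → Adj G v u
  adj-sym {u} {v} = subst T (proj₁ isTree u v)

  child-or-parent : ∀ {x z} → Adj G x z → z ≢ par x → z ≢ r × x ≡ par z
  child-or-parent a z≢ with edge-par a
  ... | inj₁ p        = p
  ... | inj₂ (_ , eq) = ⊥-elim (z≢ eq)

  -- `Rooting` leaves `par r` open, so `par` may oscillate between the root and a child; anywhere
  -- else two steps lower the depth by 2.
  par≢ : ∀ {v} → v ≢ r → par (par v) ≡ v → par v ≡ r
  par≢ {v} v≢r eq with par v ≟ r
  ... | yes p = p
  ... | no p  = ⊥-elim (ℕₚ.m≢1+n+m (depth v) {1}
    (trans (par-depth v≢r) (cong suc (trans (par-depth p) (cong (suc ∘ depth) eq)))))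

  depth-bound : ∃[ b ] ∀ v → depth v ≤ b
  depth-bound = bound (allFin n) .proj₁ , λ v → bound (allFin n) .proj₂ (∈-allFin v)
    where
    bound : ∀ vs → ∃[ b ] ∀ {v} → v ∈ vs → depth v ≤ b
    bound []       = 0 , λ ()
    bound (v ∷ vs) with bound vs
    ... | b , p = depth v ⊔ b , λ { (here refl) → ℕₚ.m≤m⊔n (depth v) b
                                  ; (there v∈)  → ℕₚ.≤-trans (p v∈) (ℕₚ.m≤n⊔m (depth v) b) }

  -- entering y from its parent, the face walk sees all children of y in rotation order;
  -- it may leave through par y before z comes up, but then rotation starts over at the same dart
  around : ∀ {y} → (∀ {z} → z ≢ r → par z ≡ y → Reach face (y , z) (z , y)) → y ≢ r →
           ∀ j → Reach face (par y , y) (y , iter (rot R y) j (rot R y (par y)))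
  around {y} turn y≢r zero = reach-step face (reach-refl face)
  around {y} turn y≢r (suc j) with iter (rot R y) j (rot R y (par y)) in eq
  ... | z with z ≟ par y
  ...   | yes refl = reach-step face (reach-refl face)
  ...   | no z≢ = reach-step face (reach-trans face
            (subst (λ w → Reach face (par y , y) (y , w)) eq (around turn y≢r j))
            (turn (proj₁ child) (sym (proj₂ child))))
    where
    child : z ≢ r × y ≡ par z
    child = child-or-parent (subst (Adj G y) eq (iter-adj j (closed R y (par y) (par-adj y≢r)))) z≢

  -- The walk that enters y comes back after the subtree below y. The induction runs from the
  -- deepest level upward, k bounding the number of levels left below y.
  turn-back : ∀ k {y} → y ≢ r → proj₁ depth-bound < depth y + k → Reach face (par y , y) (y , par y)
  turn-back zero {y} y≢r lt = ⊥-elim (ℕₚ.<⇒≱ lt (ℕₚ.≤-trans (ℕₚ.≤-reflexive (ℕₚ.+-identityʳ _)) (proj₂ depth-bound y)))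
  turn-back (suc k) {y} y≢r lt with cyclic R y (rot R y (par y)) (par y) (closed R y (par y) (par-adj y≢r)) (par-adj y≢r)
  ... | j , eq = subst (λ w → Reach face (par y , y) (y , w)) eq (around turn y≢r j)
    where
    turn : ∀ {z} → z ≢ r → par z ≡ y → Reach face (y , z) (z , y)
    turn {z} z≢r refl = turn-back k z≢r (subst (proj₁ depth-bound <_)
      (trans (ℕₚ.+-suc (depth y) k) (cong (_+ k) (sym (par-depth z≢r)))) lt)

  turned : ∀ {y} → y ≢ r → Reach face (par y , y) (y , par y)
  turned {y} y≢r = turn-back (suc (proj₁ depth-bound)) y≢r (ℕₚ.m≤n+m _ (depth y))

  turned′ : ∀ {y z} → z ≢ r → par z ≡ y → Reach face (y , z) (z , y)
  turned′ z≢r refl = turned z≢r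

  child-of-root : ∀ {c} → Adj G r c → c ≢ r × r ≡ par c
  child-of-root a with edge-par a
  ... | inj₁ p         = p
  ... | inj₂ (r≢r , _) = ⊥-elim (r≢r refl)

  around-root : ∀ {c} → Adj G r c → ∀ j → Reach face (r , c) (r , iter (rot R r) j c)
  around-root a zero = reach-refl face
  around-root a (suc j) with child-of-root (iter-adj j a)
  ... | z≢r , eq = reach-step face (reach-trans face (around-root a j) (turned′ z≢r (sym eq)))

  module FromRoot {c : Fin n} (a : Adj G r c) where

    -- Induction along the path from the root: once the dart entering `par y` is reached, `around`
    -- leads on to y.
    down : ∀ b {y} → depth y < b → y ≢ r → Reach face (r , c) (par y , y)
    down (suc b) {y} (s≤s d<b) y≢r with par y ≟ r
    ... | yes p with cyclic R r c y a (subst (λ w → Adj G w y) p (adj-sym (par-adj y≢r)))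
    ...   | j , eq = subst (Reach face (r , c)) (cong₂ _,_ (sym p) eq) (around-root a j)
    down (suc b) {y} (s≤s d<b) y≢r | no p
        with cyclic R (par y) (rot R (par y) (par (par y))) y (closed R _ _ (par-adj p)) (adj-sym (par-adj y≢r))
    ... | j , eq = reach-trans face (down b (ℕₚ.<-≤-trans (ℕₚ.≤-reflexive (sym (par-depth y≢r))) d<b) p)
                     (subst (λ w → Reach face _ (par y , w)) eq (around turned′ p j))

    all : ∀ {u v} → Adj G u v → Reach face (r , c) (u , v)
    all {u} {v} uv with edge-par uv
    ... | inj₁ (v≢r , refl) = down (suc (depth v)) ℕₚ.≤-refl v≢r
    ... | inj₂ (u≢r , refl) = reach-trans face (down (suc (depth u)) ℕₚ.≤-refl u≢r) (turned u≢r)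

  nonRoots : List (Fin n)
  nonRoots = filter (λ v → ¬? (v ≟ r)) (allFin n)

  -- Each non-root vertex stands for the edge to its parent, hence for two darts. This makes their
  -- number 2 (n - 1), the number of steps in `leafOrder`.
  darts : List (Fin n × Fin n)
  darts = map (λ v → par v , v) nonRoots ++ map (λ v → v , par v) nonRoots

  nonRoot⁻ : ∀ {v} → v ∈ nonRoots → v ≢ r
  nonRoot⁻ v∈ = proj₂ (∈-filter⁻ (λ v → ¬? (v ≟ r)) {xs = allFin n} v∈)

  nonRoot⁺ : ∀ {v} → v ≢ r → v ∈ nonRoots
  nonRoot⁺ v≢r = ∈-filter⁺ (λ v → ¬? (v ≟ r)) (∈-allFin _) v≢r

  dart⁺ : ∀ {u v} → Adj G u v → (u , v) ∈ darts
  dart⁺ a with edge-par a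
  ... | inj₁ (v≢r , refl) = ∈-++⁺ˡ (∈-map⁺ (λ v → par v , v) (nonRoot⁺ v≢r))
  ... | inj₂ (u≢r , refl) = ∈-++⁺ʳ _ (∈-map⁺ (λ v → v , par v) (nonRoot⁺ u≢r))

  dart⁻ : ∀ {d} → d ∈ darts → Adj G (proj₁ d) (proj₂ d)
  dart⁻ d∈ with ∈-++⁻ (map (λ v → par v , v) nonRoots) d∈
  ... | inj₁ p with ∈-map⁻ (λ v → par v , v) p
  ...   | v , v∈ , refl = adj-sym (par-adj (nonRoot⁻ v∈))
  dart⁻ d∈ | inj₂ p with ∈-map⁻ (λ v → v , par v) p
  ...   | v , v∈ , refl = par-adj (nonRoot⁻ v∈)

  unique-nonRoots : Unique nonRoots
  unique-nonRoots = Uniq.filter⁺ (λ v → ¬? (v ≟ r)) (Uniq.allFin⁺ n)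

  unique-darts : Unique darts
  unique-darts = Uniq.++⁺ (Uniq.map⁺ (cong proj₂) unique-nonRoots) (Uniq.map⁺ (cong proj₁) unique-nonRoots) disjoint
    where
    disjoint : ∀ {d} → ¬ (d ∈ map (λ v → par v , v) nonRoots × d ∈ map (λ v → v , par v) nonRoots)
    disjoint (p , q) with ∈-map⁻ (λ v → par v , v) p | ∈-map⁻ (λ v → v , par v) q
    ... | v , v∈ , refl | w , w∈ , eq =
      nonRoot⁻ w∈ (trans (sym (cong proj₁ eq)) (par≢ (nonRoot⁻ v∈) (trans (cong par (cong proj₁ eq)) (sym (cong proj₂ eq)))))

  length-nonRoots : suc (length nonRoots) ≡ n
  length-nonRoots = ℕₚ.≤-antisym
    (subst (suc (length nonRoots) ≤_) (length-tabulate id)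
      (unique-⊆-length {ys = allFin n} (All.tabulate (λ v∈ r≡v → nonRoot⁻ v∈ (sym r≡v)) ∷ unique-nonRoots) (λ _ → ∈-allFin _)))
    (subst (_≤ suc (length nonRoots)) (length-tabulate id)
      (unique-⊆-length (Uniq.allFin⁺ n) λ {v} _ → all-listed v))
    where
    all-listed : ∀ v → v ∈ r ∷ nonRoots
    all-listed v with v ≟ r
    ... | yes v≡r = here v≡r
    ... | no v≢r  = there (nonRoot⁺ v≢r)

  length-darts : length darts ≡ 2 * (n ∸ 1)
  length-darts = trans (length-++ (map _ nonRoots))
    (trans (cong₂ _+_ (trans (length-map _ nonRoots) len) (trans (length-map _ nonRoots) len))
           (cong ((n ∸ 1) +_) (sym (ℕₚ.+-identityʳ (n ∸ 1)))))
    where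
    len : length nonRoots ≡ n ∸ 1
    len = cong (_∸ 1) length-nonRoots

  face-injective : ∀ x y → Adj G (proj₁ x) (proj₂ x) → Adj G (proj₁ y) (proj₂ y) → face x ≡ face y → x ≡ y
  face-injective (u , v) (u′ , v′) a a′ eq with cong proj₁ eq
  ... | refl = cong (_, v) (rot-injective (adj-sym a) (adj-sym a′) (cong proj₂ eq))

  open SingleOrbit face darts unique-darts (≡-dec _≟_ _≟_)
    (λ d∈ → dart⁺ (closed R _ _ (adj-sym (dart⁻ d∈))))
    (λ {x} {y} x∈ y∈ eq → face-injective x y (dart⁻ x∈) (dart⁻ y∈) eq) public

  module Tour {c : Fin n} (rc : Adj G r c) {u v : Fin n} (uv : Adj G u v) where

    -- All darts are reached from (r , c). As they form a single cycle, (u , v) leads back to (r ,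
    -- c) and can replace it as starting point.
    open From (dart⁺ uv) (λ x∈ → reach-trans face
      (From.reach-back (dart⁺ rc) (FromRoot.all rc ∘ dart⁻) (dart⁺ uv)) (FromRoot.all rc (dart⁻ x∈))) public

-- Consecutive leaves on the boundary walk

lastOr : {A : Set} → A → List A → A
lastOr a []       = a
lastOr a (b ∷ bs) = lastOr b bs

module Neighbours {n : ℕ} (G : Graph n) where

  nbrs : Fin n → List (Fin n)
  nbrs u = filterᵇ (G u) (allFin n)

  nbr⁺ : ∀ {u v} → Adj G u v → v ∈ nbrs u
  nbr⁺ {u} {v} a = ∈-filter⁺ (T? ∘ G u) (∈-allFin v) a

  nbr⁻ : ∀ {u v} → v ∈ nbrs u → Adj G u v
  nbr⁻ {u} v∈ = proj₂ (∈-filter⁻ (T? ∘ G u) {xs = allFin n} v∈)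

  unique-nbrs : ∀ u → Unique (nbrs u)
  unique-nbrs u = Uniq.filter⁺ (T? ∘ G u) (Uniq.allFin⁺ n)

  Leaf : Fin n → Set
  Leaf v = T (isLeaf G v)

  leaf-deg : ∀ {v} → Leaf v → deg G v ≡ 1
  leaf-deg {v} = ℕₚ.≡ᵇ⇒≡ (deg G v) 1

  leaf-nbr : ∀ {v x y} → Leaf v → Adj G v x → Adj G v y → x ≡ y
  leaf-nbr {v} lf ax ay = single (nbrs v) (leaf-deg lf) (nbr⁺ ax) (nbr⁺ ay)
    where
    single : ∀ {x y} (xs : List (Fin n)) → length xs ≡ 1 → x ∈ xs → y ∈ xs → x ≡ y
    single (_ ∷ []) _ (here refl) (here refl) = refl

  only-nbr-leaf : ∀ {v x} → Adj G v x → (∀ {y} → Adj G v y → y ≡ x) → Leaf v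
  only-nbr-leaf {v} {x} a only = ℕₚ.≡⇒≡ᵇ (deg G v) 1 (ℕₚ.≤-antisym
    (unique-⊆-length {ys = x ∷ []} (unique-nbrs v) (λ y∈ → here (only (nbr⁻ y∈))))
    (unique-⊆-length {xs = x ∷ []} ([] ∷ []) λ { (here refl) → nbr⁺ a }))

module LeafCycle {n : ℕ} {G : Graph n} (isTree : IsTree G) {r : Fin n} (rooting : Rooting G r)
  (R : RotationSystem G) (3≤deg-r : 3 ≤ deg G r) where

  open Rooting rooting
  open RotationLemmas R
  open TreeFace isTree rooting R
  open Neighbours G

  -- The condition `par z ≢ r` is there because the rotation at the root has no parent to start
  -- from.
  First : Fin n → Set
  First z = z ≢ r × par z ≢ r × rot R (par z) (par (par z)) ≡ z

  Last : Fin n → Set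
  Last z = z ≢ r × par z ≢ r × rot R (par z) z ≡ par (par z)

  -- Unless the two are siblings, the deeper one is coloured later, and it is the one that has to be
  -- special in order to react to the other. In `crossing` both are special, so their depths are
  -- left open.
  data Next (a b : Fin n) : Set where
    siblings   : par a ≡ par b → Next a b
    descending : depth a < depth b → First b → Next a b
    ascending  : depth b < depth a → Last a → Next a b
    crossing   : Last a → First b → Next a b

  leaf≢root : ∀ {v} → Leaf v → v ≢ r
  leaf≢root lf refl with ℕₚ.≤-trans 3≤deg-r (ℕₚ.≤-reflexive (leaf-deg lf))
  ... | s≤s ()

  par-not-leaf : ∀ {v} → v ≢ r → ¬ Leaf (par v)
  par-not-leaf {v} v≢r lf = leaf≢root lf
    (par≢ v≢r (leaf-nbr lf (par-adj (leaf≢root lf)) (adj-sym (par-adj v≢r))))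

  -- a is the last leaf met before the face walk traverses the given dart
  data After (a : Fin n) : Fin n × Fin n → Set where
    up   : ∀ {x y} → x ≢ r → y ≡ par x → x ≡ a ⊎ (depth x < depth a × Last a) → After a (x , y)
    down : ∀ {x y} → y ≢ r → x ≡ par y → Next a y → After a (x , y)

  after-leaf : ∀ {x y} → Adj G x y → Leaf y → After y (face (x , y))
  after-leaf {x} {y} a lf = up (leaf≢root lf) (leaf-nbr lf (closed R y x (adj-sym a)) (par-adj (leaf≢root lf))) (inj₁ refl)

  after-next : ∀ {a x y} → After a (x , y) → Leaf y → Next a y
  after-next (up x≢r refl _) lf = ⊥-elim (par-not-leaf x≢r lf)
  after-next (down _ _ next) lf = next

  -- If the rotation fixed the parent, then by cyclicity the parent would be the only neighbour of
  -- y.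
  first-child : ∀ {y} → y ≢ r → ¬ Leaf y → rot R y (par y) ≢ r × y ≡ par (rot R y (par y))
  first-child {y} y≢r ¬lf = child-or-parent (closed R y (par y) (par-adj y≢r)) λ fixed →
    ¬lf (only-nbr-leaf (par-adj y≢r) λ {z} a → let k , eq = cyclic R y (par y) z (par-adj y≢r) a in
      trans (sym eq) (iter-fixed fixed k))
    where
    iter-fixed : rot R y (par y) ≡ par y → ∀ k → iter (rot R y) k (par y) ≡ par y
    iter-fixed fixed zero    = refl
    iter-fixed fixed (suc k) = trans (cong (rot R y) (iter-fixed fixed k)) fixed

  depth-child : ∀ {y z} → z ≢ r → y ≡ par z → depth z ≡ suc (depth y)
  depth-child z≢r refl = par-depth z≢r

  -- Turning at the parent of a gives `siblings`; turning higher up gives `ascending`, since the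
  -- vertex entered has the depth of x, less than that of a. Every further step down enters a first
  -- child. It may use up the advantage in depth, which is why `ascending` becomes `crossing`.
  after-inner : ∀ {a x y} → a ≢ r → After a (x , y) → ¬ Leaf y → After a (face (x , y))
  after-inner {a} {x} a≢r (up x≢r refl last) ¬lf with edge-par (closed R (par x) x (adj-sym (par-adj x≢r)))
  after-inner a≢r (up x≢r refl (inj₁ refl)) ¬lf | inj₁ (z≢r , eq) = down z≢r eq (siblings eq)
  after-inner {a} a≢r (up x≢r refl (inj₂ (lt , last))) ¬lf | inj₁ (z≢r , eq) =
    down z≢r eq (ascending (subst (_< depth a) (trans (par-depth x≢r) (sym (depth-child z≢r eq))) lt) last)
  after-inner a≢r (up x≢r refl (inj₁ refl)) ¬lf | inj₂ (y≢r , eq) =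
    up y≢r eq (inj₂ (ℕₚ.≤-reflexive (sym (par-depth x≢r)) , x≢r , y≢r , eq))
  after-inner a≢r (up x≢r refl (inj₂ (lt , last))) ¬lf | inj₂ (y≢r , eq) =
    up y≢r eq (inj₂ (ℕₚ.<-trans (ℕₚ.≤-reflexive (sym (par-depth x≢r))) lt , last))
  after-inner {a} {x} {y} a≢r (down y≢r refl next) ¬lf with first-child y≢r ¬lf
  ... | z≢r , eq = down z≢r eq (next′ next)
    where
    z = rot R y (par y)
    first : First z
    first = z≢r , (λ p → y≢r (trans eq p)) , subst (λ w → rot R w (par w) ≡ z) eq refl
    y<z : depth y < depth z
    y<z = ℕₚ.≤-reflexive (sym (depth-child z≢r eq))
    next′ : Next a y → Next a z
    next′ (siblings p)      = descending (subst (_< depth z) (trans (par-depth y≢r)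
                                (trans (cong (suc ∘ depth) (sym p)) (sym (par-depth a≢r)))) y<z) first
    next′ (descending lt _) = descending (ℕₚ.<-trans lt y<z) first
    next′ (ascending _ l)   = crossing l first
    next′ (crossing l _)    = crossing l first

  leavesOf : ℕ → Fin n × Fin n → List (Fin n)
  leavesOf k d = map proj₂ (filterᵇ (λ d → isLeaf G (proj₂ d)) (orbit face k d))

  Dart : Fin n × Fin n → Set
  Dart d = Adj G (proj₁ d) (proj₂ d)

  face-dart : ∀ {d} → Dart d → Dart (face d)
  face-dart a = closed R _ _ (adj-sym a)

  track : ∀ {a} k d → Dart d → a ≢ r → After a d →
          Linked Next (a ∷ leavesOf k d) × After (lastOr a (leavesOf k d)) (iter face k d)
  track zero    d           dart a≢r af = [-] , af
  track {a} (suc k) d@(x , y) dart a≢r af with isLeaf G y in eq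
  ... | true  = let l , af′ = track k (face d) (face-dart {d} dart) (leaf≢root lf) (after-leaf dart lf) in
                after-next af lf ∷ l , subst (After _) (iter-suc face k d) af′
    where
    lf : Leaf y
    lf = subst T (sym eq) tt
  ... | false = let l , af′ = track k (face d) (face-dart {d} dart) a≢r (after-inner a≢r af (subst T eq)) in
                l , subst (After _) (iter-suc face k d) af′

  -- No leaf precedes the start, so this first round has a state only from its first leaf on. Its
  -- purpose is the state at the end, for the last leaf of the round.
  track₀ : ∀ k d → Dart d → leavesOf k d ≡ [] ⊎
           ∃[ b ] ∃[ bs ] (leavesOf k d ≡ b ∷ bs × lastOr b bs ≢ r × After (lastOr b bs) (iter face k d))
  track₀ zero d dart = inj₁ refl
  track₀ (suc k) d@(x , y) dart with isLeaf G y in eq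
  ... | true  = inj₂ (y , leavesOf k (face d) , refl , last≢r (leavesOf k (face d)) (leaf≢root lf) (λ b∈ → leaves≢r k (face d) b∈) ,
                  subst (After _) (iter-suc face k d)
                    (proj₂ (track k (face d) (face-dart {d} dart) (leaf≢root lf) (after-leaf dart lf))))
    where
    lf : Leaf y
    lf = subst T (sym eq) tt
    last≢r : ∀ {b} bs → b ≢ r → (∀ {c} → c ∈ bs → c ≢ r) → lastOr b bs ≢ r
    last≢r []       p _ = p
    last≢r (c ∷ bs) _ q = last≢r bs (q (here refl)) (q ∘ there)
    leaves≢r : ∀ k d {c} → c ∈ leavesOf k d → c ≢ r
    leaves≢r k d c∈ with ∈-map⁻ proj₂ c∈
    ... | e , e∈ , refl = leaf≢root (proj₂ (∈-filter⁻ (λ e → T? (isLeaf G (proj₂ e))) {xs = orbit face k d} e∈))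
  ... | false with track₀ k (face d) (face-dart {d} dart)
  ...   | inj₁ p = inj₁ p
  ...   | inj₂ (b , bs , p , q , af) = inj₂ (b , bs , p , q , subst (After _) (iter-suc face k d) af)

  -- First children are followed until a leaf is met. The number j of steps is kept in order to
  -- recover v from the leaf in `three-leaves`.
  leaf-below : ∀ k {v} → v ≢ r → proj₁ depth-bound < depth v + k →
               ∃[ ℓ ] ∃[ j ] (Leaf ℓ × iter par j ℓ ≡ v × depth ℓ ≡ j + depth v)
  leaf-below k {v} v≢r lt with T? (isLeaf G v)
  ... | yes lf = v , 0 , lf , refl , refl
  leaf-below zero {v} v≢r lt | no _ =
    ⊥-elim (ℕₚ.<⇒≱ lt (ℕₚ.≤-trans (ℕₚ.≤-reflexive (ℕₚ.+-identityʳ _)) (proj₂ depth-bound v)))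
  leaf-below (suc k) {v} v≢r lt | no ¬lf with first-child v≢r ¬lf
  ... | z≢r , eq with leaf-below k z≢r (subst (proj₁ depth-bound <_)
                        (trans (ℕₚ.+-suc (depth v) k) (cong (_+ k) (sym (depth-child z≢r eq)))) lt)
  ...   | ℓ , j , lf , p , q = ℓ , suc j , lf , trans (cong par p) (sym eq) ,
            trans q (trans (cong (j +_) (depth-child z≢r eq)) (ℕₚ.+-suc j (depth v)))

  leafUnder : ∀ {v} → v ≢ r → ∃[ ℓ ] ∃[ j ] (Leaf ℓ × iter par j ℓ ≡ v × depth ℓ ≡ j + depth v)
  leafUnder {v} v≢r = leaf-below (suc (proj₁ depth-bound)) v≢r (ℕₚ.m≤n+m _ (depth v))

  module Boundary {u v : Fin n} (uv : Adj G u v) where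

    rootChild : ∃[ c ] Adj G r c
    rootChild = member (nbrs r) 3≤deg-r .proj₁ , nbr⁻ (member (nbrs r) 3≤deg-r .proj₂)
      where
      member : (xs : List (Fin n)) → 3 ≤ length xs → ∃[ c ] c ∈ xs
      member (c ∷ _) _ = c , here refl

    open Tour (proj₂ rootChild) uv

    leaves : List (Fin n)
    leaves = leavesOf N (u , v)

    leafOrder≡ : leafOrder G R u v ≡ leaves
    leafOrder≡ = cong (λ ds → map proj₂ (filterᵇ (λ d → isLeaf G (proj₂ d)) ds))
      (trans (faceWalk-orbit (2 * (n ∸ 1)) u v) (cong (λ k → orbit face k (u , v)) (sym length-darts)))

    orbit-dart : ∀ {d} → d ∈ orbit face N (u , v) → Dart d
    orbit-dart d∈ with ∈-orbit⁻ face (u , v) d∈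
    ... | i , _ , refl = dart⁻ (iter-∈ i (dart⁺ uv))

    leaves-leaf : ∀ {ℓ} → ℓ ∈ leaves → Leaf ℓ
    leaves-leaf ℓ∈ with ∈-map⁻ proj₂ ℓ∈
    ... | d , d∈ , refl = proj₂ (∈-filter⁻ (λ e → T? (isLeaf G (proj₂ e))) {xs = orbit face N (u , v)} d∈)

    leaf∈leaves : ∀ {ℓ} → Leaf ℓ → ℓ ∈ leaves
    leaf∈leaves {ℓ} lf = ∈-map⁺ proj₂ (∈-filter⁺ (λ e → T? (isLeaf G (proj₂ e)))
      (covers (dart⁺ (adj-sym (par-adj (leaf≢root lf))))) lf)

    -- Only one dart enters a leaf, and the orbit has no repeated darts.
    unique-leaves : Unique leaves
    unique-leaves = unique-map inj (Uniq.filter⁺ (λ e → T? (isLeaf G (proj₂ e))) unique)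
      where
      inj : ∀ {d e} → d ∈ filterᵇ (λ e → isLeaf G (proj₂ e)) (orbit face N (u , v)) →
                      e ∈ filterᵇ (λ e → isLeaf G (proj₂ e)) (orbit face N (u , v)) → proj₂ d ≡ proj₂ e → d ≡ e
      inj {x , y} {x′ , .y} d∈ e∈ refl =
        let p , lf = ∈-filter⁻ (λ e → T? (isLeaf G (proj₂ e))) {xs = orbit face N (u , v)} d∈
            q , _  = ∈-filter⁻ (λ e → T? (isLeaf G (proj₂ e))) {xs = orbit face N (u , v)} e∈
        in cong (_, y) (leaf-nbr lf (adj-sym (orbit-dart p)) (adj-sym (orbit-dart q)))

    -- One leaf is chosen below each neighbour of the root. If two of these leaves agree, so do
    -- their depths, hence the same number of steps leads back from them, to the same neighbour.
    three-leaves : 3 ≤ length leaves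
    three-leaves = ℕₚ.≤-trans 3≤deg-r (subst (_≤ length leaves) (length-map under (nbrs r))
      (unique-⊆-length (unique-map under-injective (unique-nbrs r)) λ ℓ∈ →
        let c , c∈ , eq = ∈-map⁻ under ℓ∈ in subst (_∈ leaves) (sym eq) (leaf∈leaves (under-leaf c∈))))
      where
      under : Fin n → Fin n
      under c with c ≟ r
      ... | yes _ = r
      ... | no p  = proj₁ (leafUnder p)
      under-leaf : ∀ {c} → c ∈ nbrs r → Leaf (under c)
      under-leaf {c} c∈ with c ≟ r
      ... | yes refl = ⊥-elim (subst T (proj₁ (proj₂ isTree) r) (nbr⁻ c∈))
      ... | no p     = proj₁ (proj₂ (proj₂ (leafUnder p)))
      depth₁ : ∀ {c} → c ∈ nbrs r → depth c ≡ 1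
      depth₁ c∈ with child-of-root (nbr⁻ c∈)
      ... | c≢r , eq = trans (depth-child c≢r eq) (cong suc depth-root)
      under-injective : ∀ {c c′} → c ∈ nbrs r → c′ ∈ nbrs r → under c ≡ under c′ → c ≡ c′
      under-injective {c} {c′} c∈ c′∈ eq with c ≟ r | c′ ≟ r
      ... | yes refl | _ = ⊥-elim (proj₁ (child-of-root (nbr⁻ c∈)) refl)
      ... | no _ | yes refl = ⊥-elim (proj₁ (child-of-root (nbr⁻ c′∈)) refl)
      ... | no p | no p′ with leafUnder p | leafUnder p′
      ...   | ℓ , j , _ , q , h | ℓ′ , j′ , _ , q′ , h′ = trans (sym q) (trans (cong₂ (iter par) j≡ eq) q′)
        where
        j≡ : j ≡ j′
        j≡ = ℕₚ.+-cancelʳ-≡ 1 j j′ (trans (cong (j +_) (sym (depth₁ c∈))) (trans (sym h)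
               (trans (cong depth eq) (trans h′ (cong (j′ +_) (depth₁ c′∈))))))

    cyclic-next : ∃[ b ] ∃[ bs ] (leaves ≡ b ∷ bs × Linked Next (lastOr b bs ∷ b ∷ bs))
    cyclic-next with track₀ N (u , v) uv
    ... | inj₁ none = ⊥-elim (absurd (subst (λ xs → 3 ≤ length xs) none three-leaves))
      where
      absurd : ¬ 3 ≤ 0
      absurd ()
    -- By `period` the walk is back at its first dart, so the final state of the first round is the
    -- initial state of a second one.
    ... | inj₂ (b , bs , p , q , af) = b , bs , p ,
      subst (λ xs → Linked Next (lastOr b bs ∷ xs)) p (proj₁ (track N (u , v) uv q (subst (After _) period af)))

-- Star edge colouring of cycles

even : ℕ → Bool
even zero    = true
even (suc n) = not (even n)

clash : ∀ {b} → b ≡ true → b ≡ false → ⊥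
clash refl ()

next : ℕ → ℕ → ℕ
next m i with suc i ℕₚ.≟ m
... | yes _ = 0
... | no  _ = suc i

next-suc : ∀ {m i} → suc i ≢ m → next m i ≡ suc i
next-suc {m} {i} ne with suc i ℕₚ.≟ m
... | yes eq = ⊥-elim (ne eq)
... | no _   = refl

next-< : ∀ {m i} → i < m → next m i < m
next-< {m} {i} i<m with suc i ℕₚ.≟ m
... | yes _ = ℕₚ.≤-<-trans z≤n i<m
... | no ne = ℕₚ.≤∧≢⇒< i<m ne

-- the edges of the cycle are numbered 0, …, m - 1
CycleStar : ℕ → (ℕ → ℕ) → Set
CycleStar m c = (∀ {i} → i < m → c i ≢ c (next m i)) ×
                (∀ {i} → i < m → c i ≡ c (next m (next m i)) → c (next m i) ≢ c (next m (next m (next m i))))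

-- an order in which greedy colouring of the cycle meets at most two earlier conflicts per edge
record CycleScheme (m : ℕ) : Set where
  field
    rank : ℕ → ℕ
    conf : ℕ → List ℕ
    two  : ∀ i → length (conf i) ≤ 2
    star : ∀ (c : ℕ → ℕ) → (∀ i j → j ∈ conf i → rank j < rank i → c i ≢ c j) → CycleStar m c

-- odd edges first, any two consecutive ones of them differing; then even edges only have to avoid their neighbours
module EvenScheme (k : ℕ) (even-m : even (4 + k) ≡ true) where

  m : ℕ
  m = 4 + k

  pred′ : ℕ → ℕ
  pred′ zero    = 3 + k
  pred′ (suc i) = i

  rank : ℕ → ℕ
  rank i = if even i then m + i else i

  -- The entry 1 closes the cycle of odd edges: two steps after m - 1 comes 1.
  conf : ℕ → List ℕ
  conf i = if even i then pred′ i ∷ suc i ∷ [] else i ∸ 2 ∷ 1 ∷ []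

  two : ∀ i → length (conf i) ≤ 2
  two i with even i
  ... | true  = ℕₚ.≤-refl
  ... | false = ℕₚ.≤-refl

  even-rank : ∀ {i} → even i ≡ true → rank i ≡ m + i
  even-rank {i} p = cong (λ b → if b then m + i else i) p

  odd-rank : ∀ {i} → even i ≡ false → rank i ≡ i
  odd-rank {i} p = cong (λ b → if b then m + i else i) p

  even-conf : ∀ {i j} → even i ≡ true → j ∈ pred′ i ∷ suc i ∷ [] → j ∈ conf i
  even-conf {i} {j} p = subst (j ∈_) (sym (cong (λ b → if b then pred′ i ∷ suc i ∷ [] else (i ∸ 2 ∷ 1 ∷ [])) p))

  odd-conf : ∀ {i j} → even i ≡ false → j ∈ i ∸ 2 ∷ 1 ∷ [] → j ∈ conf i
  odd-conf {i} {j} p = subst (j ∈_) (sym (cong (λ b → if b then pred′ i ∷ suc i ∷ [] else (i ∸ 2 ∷ 1 ∷ [])) p))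

  module _ (c : ℕ → ℕ) (differ : ∀ i j → j ∈ conf i → rank j < rank i → c i ≢ c j) where

    even-avoids : ∀ {i j} → even i ≡ true → even j ≡ false → j < m + i → j ∈ pred′ i ∷ suc i ∷ [] → c i ≢ c j
    even-avoids {i} {j} p q j< j∈ = differ i j (even-conf p j∈)
      (subst (rank j <_) (sym (even-rank {i} p)) (subst (_< m + i) (sym (odd-rank {j} q)) j<))

    odd-avoids : ∀ {i j} → even i ≡ false → even j ≡ false → j < i → j ∈ i ∸ 2 ∷ 1 ∷ [] → c i ≢ c j
    odd-avoids {i} {j} p q j< j∈ = differ i j (odd-conf p j∈)
      (subst (rank j <_) (sym (odd-rank {i} p)) (subst (_< i) (sym (odd-rank {j} q)) j<))

    proper : ∀ {i} → i < m → c i ≢ c (next m i)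
    proper {i} i<m with even i in p | suc i ℕₚ.≟ m
    ... | true  | yes refl = ⊥-elim (clash even-m (cong not p))
    ... | true  | no ne    = even-avoids {i} p (cong not p) (ℕₚ.<-≤-trans (ℕₚ.≤∧≢⇒< i<m ne) (ℕₚ.m≤m+n m i)) (there (here refl))
    ... | false | yes refl = ≢-sym (even-avoids {0} refl p (ℕₚ.<-≤-trans i<m (ℕₚ.m≤m+n m 0)) (here refl))
    ... | false | no ne    = ≢-sym (even-avoids {suc i} (cong not p) p (ℕₚ.<-≤-trans i<m (ℕₚ.m≤m+n m (suc i))) (here refl))

    odd-chain : ∀ {j} → even j ≡ false → c j ≢ c (next m (next m j))
    odd-chain {j} p with suc j ℕₚ.≟ m
    ... | yes refl = odd-avoids {3 + k} p refl (s≤s (s≤s z≤n)) (there (here refl))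
    ... | no _ with suc (suc j) ℕₚ.≟ m
    ...   | yes refl = ⊥-elim (clash even-m (cong (not ∘ not) p))
    ...   | no _     = ≢-sym (odd-avoids {suc (suc j)} (cong (not ∘ not) p) p (s≤s (ℕₚ.n≤1+n j)) (here refl))

    -- Four consecutive edges contain two odd ones at distance two, and these differ.
    windows : ∀ {i} → i < m → c i ≡ c (next m (next m i)) → c (next m i) ≢ c (next m (next m (next m i)))
    windows {i} i<m eq with even i in p
    ... | false = ⊥-elim (odd-chain {i} p eq)
    ... | true  = odd-chain {next m i} (trans (cong even (next-suc {m} {i} λ { refl → clash even-m (cong not p) })) (cong not p))

  scheme : CycleScheme m
  scheme = record { rank = rank ; conf = conf ; two = two ; star = λ c differ → proper c differ , windows c differ }

-- here the two consecutive even edges m - 1 and 0 and their neighbours 1 and m - 2 are coloured first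
module OddScheme (k : ℕ) (odd-m : even (3 + k) ≡ false) (m≢5 : k ≢ 2) where

  m last pen : ℕ
  m    = 3 + k
  last = 2 + k
  pen  = 1 + k

  data View (i : ℕ) : Set where
    isZero : i ≡ 0 → View i
    isLast : i ≡ last → View i
    isOne  : i ≢ last → i ≡ 1 → View i
    isPen  : i ≢ 1 → i ≡ pen → View i
    isOdd  : i ≢ 1 → i ≢ last → i ≢ pen → even i ≡ false → View i
    isEven : i ≢ 0 → i ≢ last → even i ≡ true → View i

  view : ∀ i → View i
  view i with i ℕₚ.≟ 0 | i ℕₚ.≟ last | i ℕₚ.≟ 1 | i ℕₚ.≟ pen | even i in p
  ... | yes i≡0 | _      | _      | _      | _     = isZero i≡0
  ... | no _    | yes eq | _      | _      | _     = isLast eq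
  ... | no _    | no n   | yes eq | _      | _     = isOne n eq
  ... | no _    | no _   | no n   | yes eq | _     = isPen n eq
  ... | no _    | no n   | no n₁  | no n₂  | false = isOdd n₁ n n₂ p
  ... | no n₀   | no n   | no n₁  | no n₂  | true  = isEven n₀ n p

  rank′ : ∀ {i} → View i → ℕ
  rank′ (isZero _) = 0
  rank′ (isLast _) = 1
  rank′ (isOne _ _) = 2
  rank′ (isPen _ _) = 3
  rank′ {i} (isOdd _ _ _ _) = 4 + i
  rank′ {i} (isEven _ _ _) = 4 + (m + i)

  conf′ : ∀ {i} → View i → List ℕ
  conf′ (isZero _) = []
  conf′ (isLast _) = 0 ∷ []
  conf′ (isOne _ _) = 0 ∷ last ∷ []
  conf′ (isPen _ _) = 0 ∷ last ∷ []
  conf′ {i} (isOdd _ _ _ _) = i ∸ 2 ∷ pen ∷ []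
  conf′ {i} (isEven _ _ _) = i ∸ 1 ∷ suc i ∷ []

  rank : ℕ → ℕ
  rank i = rank′ (view i)

  conf : ℕ → List ℕ
  conf i = conf′ (view i)

  two : ∀ i → length (conf i) ≤ 2
  two i with view i
  ... | isZero _      = z≤n
  ... | isLast _      = s≤s z≤n
  ... | isOne _ _     = ℕₚ.≤-refl
  ... | isPen _ _     = ℕₚ.≤-refl
  ... | isOdd _ _ _ _ = ℕₚ.≤-refl
  ... | isEven _ _ _  = ℕₚ.≤-refl

  even-last : even last ≡ true
  even-last = not-injective odd-m

  odd-pen : even pen ≡ false
  odd-pen = not-injective even-last

  last-view : (v : View last) → rank′ v ≡ 1 × 0 ∈ conf′ v
  last-view (isLast _)      = refl , here refl
  last-view (isOne n _)     = ⊥-elim (n refl)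
  last-view (isPen _ p)     = ⊥-elim (clash even-last (trans (cong even p) odd-pen))
  last-view (isOdd _ n _ _) = ⊥-elim (n refl)
  last-view (isEven _ n _)  = ⊥-elim (n refl)

  one-view : (v : View 1) → rank′ v ≡ 2 × (∀ {j} → j ∈ 0 ∷ last ∷ [] → j ∈ conf′ v)
  one-view (isLast ())
  one-view (isOne _ _)     = refl , id
  one-view (isPen n _)     = ⊥-elim (n refl)
  one-view (isOdd n _ _ _) = ⊥-elim (n refl)

  -- For m = 3 the edge `pen` is 1 and is seen as `isOne`; the bounds on the rank cover both views.
  pen-view : (v : View pen) → (1 < rank′ v × rank′ v < 4) × (∀ {j} → j ∈ 0 ∷ last ∷ [] → j ∈ conf′ v)
  pen-view (isLast p)      = ⊥-elim (clash even-last (trans (cong even (sym p)) odd-pen))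
  pen-view (isOne _ _)     = (s≤s (s≤s z≤n) , s≤s (s≤s (s≤s z≤n))) , id
  pen-view (isPen _ _)     = (s≤s (s≤s z≤n) , s≤s (s≤s (s≤s (s≤s z≤n)))) , id
  pen-view (isOdd _ _ n _) = ⊥-elim (n refl)
  pen-view (isEven _ _ p)  = ⊥-elim (clash p odd-pen)

  odd-rank : ∀ {i} → even i ≡ false → (v : View i) → rank′ v ≤ 4 + i
  odd-rank p (isZero _)      = z≤n
  odd-rank p (isLast _)      = s≤s z≤n
  odd-rank p (isOne _ _)     = s≤s (s≤s z≤n)
  odd-rank p (isPen _ _)     = s≤s (s≤s (s≤s z≤n))
  odd-rank p (isOdd _ _ _ _) = ℕₚ.≤-refl
  odd-rank p (isEven _ _ q)  = ⊥-elim (clash q p)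

  module _ (c : ℕ → ℕ) (differ : ∀ i j → j ∈ conf i → rank j < rank i → c i ≢ c j) where

    last≢0 : c last ≢ c 0
    last≢0 = differ last 0 (proj₂ (last-view (view last))) (subst (0 <_) (sym (proj₁ (last-view (view last)))) (s≤s z≤n))

    one≢ : ∀ {j} → rank j < 2 → j ∈ 0 ∷ last ∷ [] → c 1 ≢ c j
    one≢ {j} lt j∈ = differ 1 j (proj₂ (one-view (view 1)) j∈) (subst (rank j <_) (sym (proj₁ (one-view (view 1)))) lt)

    one≢0 : c 1 ≢ c 0
    one≢0 = one≢ (s≤s z≤n) (here refl)

    one≢last : c 1 ≢ c last
    one≢last = one≢ (subst (_< 2) (sym (proj₁ (last-view (view last)))) ℕₚ.≤-refl) (there (here refl))

    pen≢ : ∀ {j} → rank j ≤ 1 → j ∈ 0 ∷ last ∷ [] → c pen ≢ c j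
    pen≢ {j} lt j∈ = differ pen j (proj₂ (pen-view (view pen)) j∈) (ℕₚ.≤-<-trans lt (proj₁ (proj₁ (pen-view (view pen)))))

    pen≢0 : c pen ≢ c 0
    pen≢0 = pen≢ z≤n (here refl)

    pen≢last : c pen ≢ c last
    pen≢last = pen≢ (ℕₚ.≤-reflexive (proj₁ (last-view (view last)))) (there (here refl))

    odd-avoids : ∀ {i j} → i ≢ 1 → even i ≡ false → i ≢ pen → rank j < 4 + i → j ∈ i ∸ 2 ∷ pen ∷ [] → c i ≢ c j
    odd-avoids {i} {j} i≢1 p i≢pen lt j∈ with differ i j
    ... | d with view i
    ...   | isZero refl    = ⊥-elim (clash refl p)
    ...   | isLast refl    = ⊥-elim (clash even-last p)
    ...   | isOne _ q      = ⊥-elim (i≢1 q)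
    ...   | isPen _ q      = ⊥-elim (i≢pen q)
    ...   | isOdd _ _ _ _  = d j∈ lt
    ...   | isEven _ _ q   = ⊥-elim (clash q p)

    even-avoids : ∀ {i j} → i ≢ 0 → i ≢ last → even i ≡ true → even j ≡ false → j ≤ suc i → j ∈ i ∸ 1 ∷ suc i ∷ [] → c i ≢ c j
    even-avoids {i} {j} i≢0 i≢last p q j≤ j∈ with differ i j
    ... | d with view i
    ...   | isZero r      = ⊥-elim (i≢0 r)
    ...   | isLast r      = ⊥-elim (i≢last r)
    ...   | isOne _ refl  = ⊥-elim (clash p refl)
    ...   | isPen _ refl  = ⊥-elim (clash p odd-pen)
    ...   | isOdd _ _ _ r = ⊥-elim (clash p r)
    ...   | isEven _ _ _  = d j∈ (ℕₚ.≤-<-trans (odd-rank q (view j)) (ℕₚ.+-monoʳ-< 4 (s≤s (ℕₚ.≤-trans j≤ (s≤s (ℕₚ.m≤n+m i (1 + k)))))))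

    proper : ∀ {i} → i < m → c i ≢ c (next m i)
    proper {i} i<m with suc i ℕₚ.≟ m
    ... | yes refl = last≢0
    ... | no ne with i ℕₚ.≟ 0 | i ℕₚ.≟ pen | even i in p
    ...   | yes refl | _        | _     = ≢-sym one≢0
    ...   | no _     | yes refl | _     = pen≢last
    ...   | no i≢0   | no _     | true  = even-avoids {i} i≢0 (ne ∘ cong suc) p (cong not p) ℕₚ.≤-refl (there (here refl))
    ...   | no _     | no i≢pen | false = ≢-sym (even-avoids {suc i} (λ ()) (i≢pen ∘ ℕₚ.suc-injective) (cong not p) p (ℕₚ.m≤n+m i 2) (here refl))

    odd-chain : ∀ {j} → even j ≡ false → c j ≢ c (2 + j)
    odd-chain {j} p with 2 + j ℕₚ.≟ pen
    -- The odd edge two before `pen` is coloured after it and avoids it. With j = 1 both would be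
    -- coloured early, against 0 and `last` only; but then pen = 3 and m = 5.
    ... | yes refl = odd-avoids {j} (λ { refl → m≢5 refl }) p (λ q → ℕₚ.m≢1+n+m j q)
                       (ℕₚ.<-≤-trans (proj₂ (proj₁ (pen-view (view pen)))) (ℕₚ.m≤m+n 4 j)) (there (here refl))
    ... | no ne    = ≢-sym (odd-avoids {2 + j} (λ ()) (cong (not ∘ not) p) ne
                       (ℕₚ.≤-<-trans (odd-rank p (view j)) (ℕₚ.+-monoʳ-< 4 (s≤s (ℕₚ.n≤1+n j)))) (here refl))

    -- Four edges that wrap around contain `pen` and 0, or `last` and 1, at distance two; all others
    -- contain two odd edges at distance two.
    windows : ∀ {i} → i < m → c i ≡ c (next m (next m i)) → c (next m i) ≢ c (next m (next m (next m i)))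
    windows {i} i<m eq with suc i ℕₚ.≟ m
    ... | yes refl = ⊥-elim (one≢last (sym eq))
    ... | no _ with 2 + i ℕₚ.≟ m
    ...   | yes refl = ⊥-elim (pen≢0 eq)
    ...   | no _ with even i in p | 3 + i ℕₚ.≟ m
    ...     | _     | yes refl = pen≢0
    ...     | false | no _     = ⊥-elim (odd-chain {i} p eq)
    ...     | true  | no _     = odd-chain {suc i} (cong not p)

  scheme : CycleScheme m
  scheme = record { rank = rank ; conf = conf ; two = two ; star = λ c differ → proper c differ , windows c differ }

cycleScheme : ∀ {m} → 3 ≤ m → m ≢ 5 → CycleScheme m
cycleScheme {suc (suc (suc k))} (s≤s (s≤s (s≤s z≤n))) m≢5 with even (3 + k) in p
... | false = OddScheme.scheme k p (m≢5 ∘ cong (3 +_))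
cycleScheme {suc (suc (suc zero))}    _ m≢5 | true with p
... | ()
cycleScheme {suc (suc (suc (suc k)))} _ m≢5 | true = EvenScheme.scheme k p

-- Cyclic tournaments on the neighbours of a vertex

n≤1+2⌊n/2⌋ : ∀ n → n ≤ suc (⌊ n /2⌋ + ⌊ n /2⌋)
n≤1+2⌊n/2⌋ 0 = z≤n
n≤1+2⌊n/2⌋ 1 = s≤s z≤n
n≤1+2⌊n/2⌋ (suc (suc n)) = s≤s (s≤s (ℕₚ.≤-trans (n≤1+2⌊n/2⌋ n) (ℕₚ.≤-reflexive (sym (ℕₚ.+-suc ⌊ n /2⌋ ⌊ n /2⌋)))))

-- The neighbours of u, sorted by rank, form a cyclic list; out u x consists of the ⌊ deg u / 2 ⌋ entries
-- following x, so that of any two neighbours at least one belongs to the list of the other.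
module Tournament {n : ℕ} (G : Graph n) (rank : Fin n → ℕ) (rank-injective : ∀ {x y} → rank x ≡ rank y → x ≡ y) where

  open Neighbours G

  lower : Fin n → Fin n → List (Fin n)
  lower u x = filter (λ y → rank y <? rank x) (nbrs u)

  idx : Fin n → Fin n → ℕ
  idx u x = length (lower u x)

  lower⁺ : ∀ {u x y} → Adj G u y → rank y < rank x → y ∈ lower u x
  lower⁺ {u} {x} a lt = ∈-filter⁺ (λ y → rank y <? rank x) (nbr⁺ a) lt

  lower⁻ : ∀ {u x y} → y ∈ lower u x → Adj G u y × rank y < rank x
  lower⁻ {u} {x} y∈ = let p , q = ∈-filter⁻ (λ y → rank y <? rank x) {xs = nbrs u} y∈ in nbr⁻ p , q

  unique-lower : ∀ u x → Unique (lower u x)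
  unique-lower u x = Uniq.filter⁺ (λ y → rank y <? rank x) (unique-nbrs u)

  unique-x∷lower : ∀ u x → Unique (x ∷ lower u x)
  unique-x∷lower u x = All.tabulate (λ y∈ x≡y → ℕₚ.<-irrefl (cong rank (sym x≡y)) (proj₂ (lower⁻ {u} y∈))) ∷ unique-lower u x

  idx-mono : ∀ {u x y} → Adj G u x → rank x < rank y → idx u x < idx u y
  idx-mono {u} {x} {y} a lt = unique-⊆-length (unique-x∷lower u x)
    λ { (here refl) → lower⁺ a lt ; (there z∈) → let b , z<x = lower⁻ {u} z∈ in lower⁺ b (ℕₚ.<-trans z<x lt) }

  idx<deg : ∀ {u x} → Adj G u x → idx u x < deg G u
  idx<deg {u} {x} a = unique-⊆-length (unique-x∷lower u x)
    λ { (here refl) → nbr⁺ a ; (there z∈) → nbr⁺ (proj₁ (lower⁻ {u} z∈)) }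

  idx-injective : ∀ {u x y} → Adj G u x → Adj G u y → idx u x ≡ idx u y → x ≡ y
  idx-injective {u} {x} {y} ax ay eq with ℕₚ.<-cmp (rank x) (rank y)
  ... | tri< lt _ _  = ⊥-elim (ℕₚ.<-irrefl eq (idx-mono ax lt))
  ... | tri≈ _ req _ = rank-injective req
  ... | tri> _ _ lt  = ⊥-elim (ℕₚ.<-irrefl (sym eq) (idx-mono ay lt))

  half : Fin n → ℕ
  half u = ⌊ deg G u /2⌋

  -- Positions count modulo `deg G u`: the second alternative is the case in which the stretch
  -- following x wraps around to y.
  Out : Fin n → Fin n → Fin n → Set
  Out u x y = (idx u x < idx u y × idx u y ≤ idx u x + half u) ⊎ (idx u y + deg G u ≤ idx u x + half u)

  out? : ∀ u x y → Dec (Out u x y)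
  out? u x y = ((idx u x <? idx u y) ×-dec (idx u y ≤? idx u x + half u)) ⊎-dec (idx u y + deg G u ≤? idx u x + half u)

  out : Fin n → Fin n → List (Fin n)
  out u x = filter (out? u x) (nbrs u)

  out⁺ : ∀ {u x y} → Adj G u y → Out u x y → y ∈ out u x
  out⁺ {u} {x} a o = ∈-filter⁺ (out? u x) (nbr⁺ a) o

  out-idx : ∀ {u x y} → Out u x y → idx u y ≤ idx u x + half u
  out-idx (inj₁ (_ , le))    = le
  out-idx {u} {x} {y} (inj₂ le) = ℕₚ.≤-trans (ℕₚ.m≤m+n (idx u y) (deg G u)) le

  -- The cyclic distances from x to y and from y to x add up to `deg G u`, at most 2 `half u` + 1,
  -- so they do not both exceed `half u`.
  beats : ∀ {u x y} → idx u x < idx u y → Out u x y ⊎ Out u y x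
  beats {u} {x} {y} lt with idx u y ≤? idx u x + half u
  ... | yes le = inj₁ (inj₁ (lt , le))
  ... | no ¬le = inj₂ (inj₂ (begin
      idx u x + deg G u                 ≤⟨ ℕₚ.+-monoʳ-≤ (idx u x) (n≤1+2⌊n/2⌋ (deg G u)) ⟩
      idx u x + suc (half u + half u)   ≡⟨ ℕₚ.+-suc (idx u x) (half u + half u) ⟩
      suc (idx u x + (half u + half u)) ≡⟨ cong suc (ℕₚ.+-assoc (idx u x) (half u) (half u)) ⟨
      suc (idx u x + half u) + half u   ≤⟨ ℕₚ.+-monoˡ-≤ (half u) (ℕₚ.≰⇒> ¬le) ⟩
      idx u y + half u                  ∎))
    where open ℕₚ.≤-Reasoning

  tournament : ∀ {u x y} → Adj G u x → Adj G u y → x ≢ y → Out u x y ⊎ Out u y x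
  tournament {u} {x} {y} ax ay x≢y with ℕₚ.<-cmp (idx u x) (idx u y)
  ... | tri< lt _ _ = beats lt
  ... | tri≈ _ eq _ = ⊥-elim (x≢y (idx-injective ax ay eq))
  ... | tri> _ _ lt = [ inj₂ , inj₁ ]′ (beats lt)

  -- unrolled position of y in the cyclic list, counted from x
  unroll : Fin n → Fin n → Fin n → ℕ
  unroll u x y with idx u x <? idx u y
  ... | yes _ = idx u y
  ... | no  _ = idx u y + deg G u

  unroll-range : ∀ {u x y} → Adj G u x → Adj G u y → Out u x y → idx u x < unroll u x y × unroll u x y ≤ idx u x + half u
  unroll-range {u} {x} {y} ax ay o with idx u x <? idx u y
  ... | yes lt = lt , out-idx o
  unroll-range ax ay (inj₁ (lt , _)) | no ¬lt = ⊥-elim (¬lt lt)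
  unroll-range {u} {x} {y} ax ay (inj₂ le) | no ¬lt = ℕₚ.<-≤-trans (idx<deg ax) (ℕₚ.m≤n+m (deg G u) (idx u y)) , le

  unroll-injective : ∀ {u x y z} → Adj G u y → Adj G u z → unroll u x y ≡ unroll u x z → y ≡ z
  unroll-injective {u} {x} {y} {z} ay az eq with idx u x <? idx u y | idx u x <? idx u z
  ... | yes _ | yes _ = idx-injective ay az eq
  ... | yes _ | no _  = ⊥-elim (ℕₚ.<⇒≱ (idx<deg ay) (ℕₚ.≤-trans (ℕₚ.m≤n+m (deg G u) (idx u z)) (ℕₚ.≤-reflexive (sym eq))))
  ... | no _  | yes _ = ⊥-elim (ℕₚ.<⇒≱ (idx<deg az) (ℕₚ.≤-trans (ℕₚ.m≤n+m (deg G u) (idx u y)) (ℕₚ.≤-reflexive eq)))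
  ... | no _  | no _  = idx-injective ay az (ℕₚ.+-cancelʳ-≡ (deg G u) _ _ eq)

  -- Unrolling puts the entries injectively into the `half u` integers that follow `idx u x`.
  length-out : ∀ {u x} → Adj G u x → length (out u x) ≤ half u
  length-out {u} {x} ax = begin
    length (out u x)                              ≡⟨ length-map (unroll u x) (out u x) ⟨
    length (map (unroll u x) (out u x))           ≤⟨ unique-⊆-length unique-unrolled ⊆-range ⟩
    length (map (suc (idx u x) +_) (upTo (half u))) ≡⟨ length-map _ (upTo (half u)) ⟩
    length (upTo (half u))                        ≡⟨ length-upTo (half u) ⟩
    half u                                        ∎
    where
    open ℕₚ.≤-Reasoning
    out⁻ : ∀ {y} → y ∈ out u x → Adj G u y × Out u x y
    out⁻ y∈ = let p , q = ∈-filter⁻ (out? u x) {xs = nbrs u} y∈ in nbr⁻ p , q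
    unique-unrolled : Unique (map (unroll u x) (out u x))
    unique-unrolled = unique-map (λ y∈ z∈ → unroll-injective (proj₁ (out⁻ y∈)) (proj₁ (out⁻ z∈)))
                                 (Uniq.filter⁺ (out? u x) (unique-nbrs u))
    ⊆-range : ∀ {j} → j ∈ map (unroll u x) (out u x) → j ∈ map (suc (idx u x) +_) (upTo (half u))
    ⊆-range j∈ with ∈-map⁻ (unroll u x) j∈
    ... | y , y∈ , refl with unroll-range ax (proj₁ (out⁻ y∈)) (proj₂ (out⁻ y∈))
    ...   | lt , le = subst (_∈ map (suc (idx u x) +_) (upTo (half u))) (ℕₚ.m+[n∸m]≡n lt)
              (∈-map⁺ (suc (idx u x) +_) (∈-upTo⁺ (ℕₚ.+-cancelˡ-< (idx u x) _ _
                (ℕₚ.≤-trans (ℕₚ.≤-reflexive (ℕₚ.m+[n∸m]≡n lt)) le))))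

-- Order of colouring and conflicts of the tree edges

module DepthRank {n : ℕ} (depth : Fin n → ℕ) (special : Fin n → Bool) where

  slot : Fin n → ℕ
  slot v = (if special v then 0 else n) + toℕ v

  slot< : ∀ v → slot v < n + n
  slot< v with special v
  ... | true  = ℕₚ.<-≤-trans (toℕ<n v) (ℕₚ.m≤m+n n n)
  ... | false = ℕₚ.+-monoʳ-< n (toℕ<n v)

  -- The lexicographic order by depth, then special before ordinary, then vertex number, written in
  -- base n + n.
  rank : Fin n → ℕ
  rank v = depth v * (n + n) + slot v

  rank-depth : ∀ {x y} → depth x < depth y → rank x < rank y
  rank-depth {x} {y} lt = begin-strict
    depth x * (n + n) + slot x  <⟨ ℕₚ.+-monoʳ-< (depth x * (n + n)) (slot< x) ⟩
    depth x * (n + n) + (n + n) ≡⟨ ℕₚ.+-comm (depth x * (n + n)) (n + n) ⟩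
    suc (depth x) * (n + n)     ≤⟨ ℕₚ.*-monoˡ-≤ (n + n) lt ⟩
    depth y * (n + n)           ≤⟨ ℕₚ.m≤m+n _ (slot y) ⟩
    rank y                      ∎
    where open ℕₚ.≤-Reasoning

  slot-special : ∀ {x y} → special x ≡ true → special y ≡ false → slot x < slot y
  slot-special {x} {y} p q rewrite p | q = ℕₚ.<-≤-trans (toℕ<n x) (ℕₚ.m≤m+n n (toℕ y))

  slot-injective : ∀ {x y} → slot x ≡ slot y → x ≡ y
  slot-injective {x} {y} eq with special x in p | special y in q
  ... | true  | true  = toℕ-injective eq
  ... | false | false = toℕ-injective (ℕₚ.+-cancelˡ-≡ n _ _ eq)
  ... | true  | false = ⊥-elim (ℕₚ.<⇒≱ (toℕ<n x) (ℕₚ.≤-trans (ℕₚ.m≤m+n n (toℕ y)) (ℕₚ.≤-reflexive (sym eq))))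
  ... | false | true  = ⊥-elim (ℕₚ.<⇒≱ (toℕ<n y) (ℕₚ.≤-trans (ℕₚ.m≤m+n n (toℕ x)) (ℕₚ.≤-reflexive eq)))

  rank-injective : ∀ {x y} → rank x ≡ rank y → x ≡ y
  rank-injective {x} {y} eq with ℕₚ.<-cmp (depth x) (depth y)
  ... | tri< lt _ _ = ⊥-elim (ℕₚ.<-irrefl eq (rank-depth lt))
  ... | tri> _ _ lt = ⊥-elim (ℕₚ.<-irrefl (sym eq) (rank-depth lt))
  ... | tri≈ _ d _  = slot-injective (ℕₚ.+-cancelˡ-≡ (depth x * (n + n)) _ _
                        (trans eq (cong (λ k → k * (n + n) + slot y) (sym d))))

  rank-special : ∀ {x y} → depth x ≡ depth y → special x ≡ true → special y ≡ false → rank x < rank y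
  rank-special {x} {y} d p q = subst (λ k → rank x < k * (n + n) + slot y) d
    (ℕₚ.+-monoʳ-< (depth x * (n + n)) (slot-special p q))

-- The edge from v ≢ r to its parent is named v, and edge u y is the name of the edge between u and its neighbour y.
module TreeEdges {n : ℕ} {G : Graph n} {r : Fin n} (rooting : Rooting G r) where

  open Rooting rooting

  edge : Fin n → Fin n → Fin n
  edge u y with depth u <? depth y
  ... | yes _ = y
  ... | no  _ = u

  child-deeper : ∀ {u y} → y ≢ r → u ≡ par y → depth u < depth y
  child-deeper y≢r refl = ℕₚ.≤-reflexive (sym (par-depth y≢r))

  edge-child : ∀ {u y} → y ≢ r → u ≡ par y → edge u y ≡ y
  edge-child {u} {y} y≢r eq with depth u <? depth y
  ... | yes _ = refl
  ... | no ne = ⊥-elim (ne (child-deeper y≢r eq))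

  edge-parent : ∀ {u y} → u ≢ r → y ≡ par u → edge u y ≡ u
  edge-parent {u} {y} u≢r eq with depth u <? depth y
  ... | yes lt = ⊥-elim (ℕₚ.<-asym lt (child-deeper u≢r eq))
  ... | no _   = refl

  edge-sym : ∀ {u y} → Adj G u y → edge u y ≡ edge y u
  edge-sym a with edge-par a
  ... | inj₁ (y≢r , eq) = trans (edge-child y≢r eq) (sym (edge-parent y≢r eq))
  ... | inj₂ (u≢r , eq) = trans (edge-parent u≢r eq) (sym (edge-child u≢r eq))

  edge-depth : ∀ {u y} → Adj G u y → depth (edge u y) ≤ suc (depth u)
  edge-depth a with edge-par a
  ... | inj₁ (y≢r , refl) = ℕₚ.≤-trans (ℕₚ.≤-reflexive (cong depth (edge-child y≢r refl))) (ℕₚ.≤-reflexive (par-depth y≢r))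
  ... | inj₂ (u≢r , eq)   = ℕₚ.≤-trans (ℕₚ.≤-reflexive (cong depth (edge-parent u≢r eq))) (ℕₚ.n≤1+n _)

-- Special vertices come first among their siblings and in addition have to differ from the edges in near.
module TreeConflicts {n : ℕ} {G : Graph n} (isTree : IsTree G) {r : Fin n} (rooting : Rooting G r)
  (R : RotationSystem G) (special : Fin n → Bool) (near : Fin n → List (Fin n)) (length-near : ∀ v → length (near v) ≤ 2)
  (few-special : ∀ {u xs} → Unique xs → (∀ {x} → x ∈ xs → Adj G u x × (x ≡ Rooting.par rooting u ⊎ special x ≡ true)) →
     length xs ≤ 3)
  (K : ℕ)
  (edge-bound : ∀ {u w} → Adj G u w → ⌊ deg G u /2⌋ + deg G w ≤ K)
  (deg-bound : ∀ u → deg G u + 6 ≤ K)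
  where

  open Rooting rooting
  open TreeFace isTree rooting R
  open Neighbours G
  open TreeEdges rooting
  open DepthRank depth special
  open Tournament G rank rank-injective

  others : Fin n → Fin n → List (Fin n)
  others w u = filter (λ x → ¬? (x ≟ u)) (nbrs w)

  -- conflicts with the edges at w = par u, when the edge comes i-th at u
  above : Fin n → Fin n → ℕ → List (Fin n)
  above w u i with u ≟ r | i ≤? half u
  ... | yes _ | _     = []
  ... | no _  | yes _ = map (edge w) (others w u)
  ... | no _  | no _  = map (edge w) (out w u)

  extra : Fin n → List (Fin n)
  extra v = if special v then near v else []

  conf : Fin n → List (Fin n)
  conf v with v ≟ r
  ... | yes _ = []
  ... | no _  = map (edge (par v)) (lower (par v) v) ++ (above (par (par v)) (par v) (idx (par v) v) ++ extra v)

  length-others : ∀ {w u} → Adj G w u → length (others w u) < deg G w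
  length-others {w} {u} a = filter-notAll (λ x → ¬? (x ≟ u)) (nbrs w) (notAll (nbr⁺ a))
    where
    notAll : ∀ {xs} → u ∈ xs → Any (λ x → ¬ x ≢ u) xs
    notAll (here refl) = here (λ ne → ne refl)
    notAll (there u∈)  = there (notAll u∈)

  6≤K : 6 ≤ K
  6≤K = ℕₚ.≤-trans (ℕₚ.m≤n+m 6 _) (deg-bound r)

  half≤deg : ∀ u → half u ≤ deg G u
  half≤deg u = ℕₚ.⌊n/2⌋≤n (deg G u)

  -- Off the root the two cases apply `edge-bound` to the edge between u and `par u` in opposite
  -- directions.
  above-bound : ∀ {u i} → i < deg G u → i + length (above (par u) u i) < K
  above-bound {u} {i} i<deg with u ≟ r | i ≤? half u
  ... | yes _ | _ = begin-strict
      i + 0     ≡⟨ ℕₚ.+-identityʳ i ⟩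
      i         <⟨ i<deg ⟩
      deg G u   ≤⟨ ℕₚ.m≤m+n _ 6 ⟩
      deg G u + 6 ≤⟨ deg-bound u ⟩
      K         ∎
    where open ℕₚ.≤-Reasoning
  ... | no u≢r | yes i≤ = begin-strict
      i + length (map (edge (par u)) (others (par u) u)) ≡⟨ cong (i +_) (length-map (edge (par u)) (others (par u) u)) ⟩
      i + length (others (par u) u)  <⟨ ℕₚ.+-mono-≤-< i≤ (length-others (adj-sym (par-adj u≢r))) ⟩
      half u + deg G (par u)         ≤⟨ edge-bound (par-adj u≢r) ⟩
      K                              ∎
    where open ℕₚ.≤-Reasoning
  ... | no u≢r | no _ = begin-strict
      i + length (map (edge (par u)) (out (par u) u)) ≡⟨ cong (i +_) (length-map (edge (par u)) (out (par u) u)) ⟩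
      i + length (out (par u) u)  <⟨ ℕₚ.+-mono-<-≤ i<deg (length-out (adj-sym (par-adj u≢r))) ⟩
      deg G u + half (par u)      ≡⟨ ℕₚ.+-comm (deg G u) _ ⟩
      half (par u) + deg G u      ≤⟨ edge-bound (adj-sym (par-adj u≢r)) ⟩
      K                           ∎
    where open ℕₚ.≤-Reasoning

  length-above : ∀ u i → length (above (par u) u i) ≤ deg G (par u)
  length-above u i with u ≟ r | i ≤? half u
  ... | yes _  | _     = z≤n
  ... | no u≢r | yes _ = ℕₚ.≤-trans (ℕₚ.≤-reflexive (length-map (edge (par u)) (others (par u) u)))
                           (ℕₚ.<⇒≤ (length-others (adj-sym (par-adj u≢r))))
  ... | no u≢r | no _  = ℕₚ.≤-trans (ℕₚ.≤-reflexive (length-map (edge (par u)) (out (par u) u)))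
                           (ℕₚ.≤-trans (length-out (adj-sym (par-adj u≢r))) (half≤deg (par u)))

  -- An ordinary sibling has larger rank, so only the grandparent and special siblings can precede v
  -- around its parent.
  idx-special : ∀ {v} → v ≢ r → special v ≡ true → idx (par v) v ≤ 3
  idx-special {v} v≢r sp = few-special (unique-lower (par v) v) λ {x} x∈ →
    let a , lt = lower⁻ {par v} x∈ in a , kind a lt
    where
    child-kind : ∀ {x} b → special x ≡ b → depth v ≡ depth x → rank x < rank v → x ≡ par (par v) ⊎ special x ≡ true
    child-kind true  q _ _  = inj₂ q
    child-kind false q d lt = ⊥-elim (ℕₚ.<-asym lt (rank-special d sp q))
    kind : ∀ {x} → Adj G (par v) x → rank x < rank v → x ≡ par (par v) ⊎ special x ≡ true
    kind {x} a lt with edge-par a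
    ... | inj₂ (_ , eq)   = inj₁ eq
    ... | inj₁ (x≢r , eq) = child-kind (special x) refl
            (trans (par-depth v≢r) (trans (cong (suc ∘ depth) eq) (sym (par-depth x≢r)))) lt

  length-conf : ∀ v → length (conf v) < K
  length-conf v with v ≟ r
  ... | yes _  = ℕₚ.<-≤-trans (s≤s z≤n) 6≤K
  ... | no v≢r = begin-strict
      length (map (edge u) (lower u v) ++ (ab ++ extra v))
        ≡⟨ length-++ (map (edge u) (lower u v)) ⟩
      length (map (edge u) (lower u v)) + length (ab ++ extra v)
        ≡⟨ cong₂ _+_ (length-map (edge u) (lower u v)) (length-++ ab) ⟩
      i + (length ab + length (extra v))
        <⟨ bound (special v) refl ⟩
      K ∎
    where
    open ℕₚ.≤-Reasoning
    u = par v
    i = idx u v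
    ab = above (par u) u i
    bound : ∀ b → special v ≡ b → i + (length ab + length (if b then near v else [])) < K
    bound false _ = subst (λ k → i + k < K) (sym (ℕₚ.+-identityʳ (length ab))) (above-bound (idx<deg (adj-sym (par-adj v≢r))))
    -- Since its index is at most 3, a special child can afford conflicts with all edges at `par u`,
    -- whichever case of `above` applies, together with the two edges in `near`.
    bound true sp = begin-strict
        i + (length ab + length (near v)) ≤⟨ ℕₚ.+-mono-≤ (idx-special v≢r sp) (ℕₚ.+-mono-≤ (length-above u i) (length-near v)) ⟩
        3 + (deg G (par u) + 2)           ≡⟨ ℕₚ.+-comm 3 _ ⟩
        deg G (par u) + 2 + 3             ≡⟨ ℕₚ.+-assoc (deg G (par u)) 2 3 ⟩
        deg G (par u) + 5                 <⟨ ℕₚ.+-monoʳ-< (deg G (par u)) ℕₚ.≤-refl ⟩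
        deg G (par u) + 6                 ≤⟨ deg-bound (par u) ⟩
        K                                 ∎

  conf-lower : ∀ {v y} → v ≢ r → Adj G (par v) y → rank y < rank v → edge (par v) y ∈ conf v
  conf-lower {v} v≢r a lt with v ≟ r
  ... | yes p = ⊥-elim (v≢r p)
  ... | no _  = ∈-++⁺ˡ (∈-map⁺ (edge (par v)) (lower⁺ a lt))

  conf-above : ∀ {v x} → v ≢ r → x ∈ above (par (par v)) (par v) (idx (par v) v) → x ∈ conf v
  conf-above {v} v≢r x∈ with v ≟ r
  ... | yes p = ⊥-elim (v≢r p)
  ... | no _  = ∈-++⁺ʳ (map (edge (par v)) (lower (par v) v)) (∈-++⁺ˡ x∈)

  conf-near : ∀ {v x} → v ≢ r → special v ≡ true → x ∈ near v → x ∈ conf v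
  conf-near {v} {x} v≢r sp x∈ with v ≟ r
  ... | yes p = ⊥-elim (v≢r p)
  ... | no _  = ∈-++⁺ʳ (map (edge (par v)) (lower (par v) v)) (∈-++⁺ʳ (above (par (par v)) (par v) (idx (par v) v))
                  (subst (λ b → x ∈ (if b then near v else [])) (sym sp) x∈))

  above-others : ∀ {w u i y} → u ≢ r → Adj G w y → y ≢ u → i ≤ half u → edge w y ∈ above w u i
  above-others {w} {u} {i} u≢r a y≢u i≤ with u ≟ r | i ≤? half u
  ... | yes p | _     = ⊥-elim (u≢r p)
  ... | no _  | yes _ = ∈-map⁺ (edge w) (∈-filter⁺ (λ x → ¬? (x ≟ u)) (nbr⁺ a) y≢u)
  ... | no _  | no ¬p = ⊥-elim (¬p i≤)

  -- In the first case of `above` all other edges at w are listed, those in `out w u` among them.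
  above-out : ∀ {w u i y} → u ≢ r → Adj G w y → y ≢ u → Out w u y → edge w y ∈ above w u i
  above-out {w} {u} {i} u≢r a y≢u o with u ≟ r | i ≤? half u
  ... | yes p | _     = ⊥-elim (u≢r p)
  ... | no _  | yes _ = ∈-map⁺ (edge w) (∈-filter⁺ (λ x → ¬? (x ≟ u)) (nbr⁺ a) y≢u)
  ... | no _  | no _  = ∈-map⁺ (edge w) (out⁺ a o)

  module Coloured (col : Fin n → ℕ) (differ : ∀ i j → j ∈ conf i → rank j < rank i → col i ≢ col j) where

    lower-proper : ∀ {u x y} → Adj G u x → Adj G u y → rank x < rank y → col (edge u x) ≢ col (edge u y)
    lower-proper {u} {x} {y} ax ay lt with edge-par ay
    ... | inj₁ (y≢r , refl) = λ eq → differ y (edge u x) (conf-lower y≢r ax lt) rank-edge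
                                (trans (sym (cong col (edge-child y≢r refl))) (sym eq))
      where
      rank-edge : rank (edge u x) < rank y
      rank-edge with edge-par ax
      ... | inj₁ (x≢r , eq) = subst (λ w → rank w < rank y) (sym (edge-child x≢r eq)) lt
      ... | inj₂ (u≢r , eq) = subst (λ w → rank w < rank y) (sym (edge-parent u≢r eq)) (rank-depth (child-deeper y≢r refl))
    ... | inj₂ (u≢r , refl) with edge-par ax
    ...   | inj₁ (x≢r , eq) = ⊥-elim (ℕₚ.<-asym lt (rank-depth (ℕₚ.<-trans (child-deeper u≢r refl) (child-deeper x≢r eq))))
    ...   | inj₂ (_ , refl) = ⊥-elim (ℕₚ.<-irrefl refl lt)

    proper : ∀ {u x y} → Adj G u x → Adj G u y → x ≢ y → col (edge u x) ≢ col (edge u y)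
    proper {u} {x} {y} ax ay x≢y with ℕₚ.<-cmp (rank x) (rank y)
    ... | tri< lt _ _ = lower-proper ax ay lt
    ... | tri≈ _ eq _ = ⊥-elim (x≢y (rank-injective eq))
    ... | tri> _ _ lt = ≢-sym (lower-proper ay ax lt)

    -- All other neighbours are deeper than the parent. Hence `out u (par u)` consists of the
    -- children of index at most `half u`, which is the threshold in `above`: these are the children
    -- that must avoid every other edge at `par u`.
    idx-parent : ∀ {u} → u ≢ r → idx u (par u) ≡ 0
    idx-parent {u} u≢r = empty (lower u (par u)) λ y∈ → let a , lt = lower⁻ {u} y∈ in not-lower a lt
      where
      not-lower : ∀ {y} → Adj G u y → rank y < rank (par u) → ⊥
      not-lower a lt with edge-par a
      ... | inj₁ (y≢r , eq)  = ℕₚ.<-asym lt (rank-depth (ℕₚ.<-trans (child-deeper u≢r refl) (child-deeper y≢r eq)))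
      ... | inj₂ (_ , refl) = ℕₚ.<-irrefl refl lt
      empty : ∀ xs → (∀ {y : Fin n} → y ∈ xs → ⊥) → length xs ≡ 0
      empty []       _ = refl
      empty (x ∷ xs) p = ⊥-elim (p (here refl))

    -- whichever of the two edges is further from the root has the other one among its conflicts
    out-clean : ∀ {u x y z} → Adj G u x → Adj G u y → x ≢ y → Out u x y → Adj G x z → z ≢ u → col (edge x z) ≢ col (edge u y)
    out-clean {u} {x} {y} {z} ax ay x≢y o az z≢u eq with edge-par ax
    ... | inj₁ (x≢r , refl) with child-or-parent az z≢u
    ...   | z≢r , refl = differ z (edge u y)
              (conf-above z≢r (above-out x≢r ay (≢-sym x≢y) o))
              (rank-depth (ℕₚ.≤-<-trans (edge-depth ay) (ℕₚ.≤-<-trans (child-deeper x≢r refl) (child-deeper z≢r refl))))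
              (trans (sym (cong col (edge-child z≢r refl))) eq)
    out-clean {u} {x} {y} {z} ax ay x≢y o az z≢u eq | inj₂ (u≢r , refl) with child-or-parent ay (≢-sym x≢y)
    ...   | y≢r , refl = differ y (edge x z)
              (conf-above y≢r (above-others u≢r az z≢u
                (ℕₚ.≤-trans (out-idx o) (ℕₚ.≤-reflexive (cong (_+ half u) (idx-parent u≢r))))))
              (rank-depth (ℕₚ.≤-<-trans (edge-depth az) (ℕₚ.≤-<-trans (child-deeper u≢r refl) (child-deeper y≢r refl))))
              (trans (sym (cong col (edge-child y≢r refl))) (sym eq))

    near-differ : ∀ {v x} → v ≢ r → special v ≡ true → x ∈ near v → rank x < rank v → col v ≢ col x
    near-differ v≢r sp x∈ lt = differ _ _ (conf-near v≢r sp x∈) lt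

-- Positions on the adjoint cycle

nth : {A : Set} → A → List A → ℕ → A
nth d []       i       = d
nth d (x ∷ xs) zero    = x
nth d (x ∷ xs) (suc i) = nth d xs i

nth-∈ : {A : Set} (d : A) (xs : List A) {i : ℕ} → i < length xs → nth d xs i ∈ xs
nth-∈ d (x ∷ xs) {zero}  _         = here refl
nth-∈ d (x ∷ xs) {suc i} (s≤s i<m) = there (nth-∈ d xs i<m)

nth-default : {A : Set} (d : A) (xs : List A) (i : ℕ) → nth d xs i ∈ d ∷ xs
nth-default d []       i       = here refl
nth-default d (x ∷ xs) zero    = there (here refl)
nth-default d (x ∷ xs) (suc i) with nth-default d xs i
... | here p  = here p
... | there p = there (there p)

nth-∷ʳ : {A : Set} (d : A) (xs : List A) {y : A} {i : ℕ} → i < length xs → nth d (xs ++ y ∷ []) i ≡ nth d xs i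
nth-∷ʳ d (x ∷ xs) {i = zero}  _         = refl
nth-∷ʳ d (x ∷ xs) {i = suc i} (s≤s i<m) = nth-∷ʳ d xs i<m

nth-∷ʳ-last : {A : Set} (d : A) (xs : List A) {y : A} → nth d (xs ++ y ∷ []) (length xs) ≡ y
nth-∷ʳ-last d []       = refl
nth-∷ʳ-last d (x ∷ xs) = nth-∷ʳ-last d xs

nth-zip : {A B : Set} (d : A) (e : B) (xs : List A) (ys : List B) {p : A × B} → p ∈ zip xs ys →
          ∃[ i ] (i < length xs × proj₁ p ≡ nth d xs i × proj₂ p ≡ nth e ys i)
nth-zip d e (x ∷ xs) (y ∷ ys) (here refl) = 0 , s≤s z≤n , refl , refl
nth-zip d e (x ∷ xs) (y ∷ ys) (there p∈) with nth-zip d e xs ys p∈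
... | i , i<m , p , q = suc i , s≤s i<m , p , q

nth-linked : {A : Set} {R : A → A → Set} (d : A) (xs : List A) → Linked R xs → ∀ {i} → suc i < length xs →
             R (nth d xs i) (nth d xs (suc i))
nth-linked d (x ∷ y ∷ xs) (p ∷ l) {zero}  _       = p
nth-linked d (x ∷ y ∷ xs) (p ∷ l) {suc i} (s≤s q) = nth-linked d (y ∷ xs) l q
nth-linked d (x ∷ []) [-] {i} (s≤s ())

module _ {n : ℕ} where

  pos : List (Fin n) → Fin n → ℕ
  pos []       v = 0
  pos (x ∷ xs) v with v ≟ x
  ... | yes _ = 0
  ... | no _  = suc (pos xs v)

  pos-nth : ∀ d xs → Unique xs → ∀ {i} → i < length xs → pos xs (nth d xs i) ≡ i
  pos-nth d (x ∷ xs) _ {zero} _ with x ≟ x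
  ... | yes _ = refl
  ... | no ne = ⊥-elim (ne refl)
  pos-nth d (x ∷ xs) (x≢ ∷ uniq) {suc i} (s≤s i<m) with nth d xs i ≟ x
  ... | yes eq = ⊥-elim (All.lookup x≢ (nth-∈ d xs i<m) (sym eq))
  ... | no _   = cong suc (pos-nth d xs uniq i<m)

T-does : {P : Set} (p? : Dec P) → T (does p?) → P
T-does (yes p) _ = p

any⁻ : {A : Set} (p : A → Bool) (xs : List A) → T (any p xs) → ∃[ x ] (x ∈ xs × T (p x))
any⁻ p (x ∷ xs) t with Equivalence.to (T-∨ {p x}) t
... | inj₁ px = x , here refl , px
... | inj₂ t′ with any⁻ p xs t′
...   | y , y∈ , py = y , there y∈ , py

prev : ℕ → ℕ → ℕ
prev m zero    = m ∸ 1
prev m (suc i) = i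

prev-next : ∀ {m i} → i < m → prev m (next m i) ≡ i
prev-next {m} {i} i<m with suc i ℕₚ.≟ m
... | yes refl = refl
... | no _     = refl

next-injective : ∀ {m i j} → i < m → j < m → next m i ≡ next m j → i ≡ j
next-injective {m} i<m j<m eq = trans (sym (prev-next i<m)) (trans (cong (prev m) eq) (prev-next j<m))

next-next≢ : ∀ {m i} → 3 ≤ m → i < m → next m (next m i) ≢ i
next-next≢ {m} {i} 3≤m i<m eq with suc i ℕₚ.≟ m
next-next≢ {m} {i} 3≤m i<m eq | yes p with 1 ℕₚ.≟ m
... | yes refl = ℕₚ.<⇒≱ 3≤m (s≤s z≤n)
... | no _     = ℕₚ.<⇒≱ 3≤m (ℕₚ.≤-reflexive (trans (sym p) (cong suc (sym eq))))
next-next≢ {m} {i} 3≤m i<m eq | no _ with suc (suc i) ℕₚ.≟ m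
... | yes refl = ℕₚ.<⇒≱ 3≤m (ℕₚ.≤-reflexive (cong (2 +_) (sym eq)))
... | no _     = ℕₚ.<-irrefl (sym eq) (ℕₚ.m≤n+m (suc i) 1)

module CyclicList {n : ℕ} (b : Fin n) (bs : List (Fin n)) where

  m : ℕ
  m = suc (length bs)

  at : ℕ → Fin n
  at = nth b (b ∷ bs)

  cycAdj⁻ : ∀ {u v} → T (cycAdj (b ∷ bs) u v) →
            ∃[ i ] (i < m × ((u ≡ at i × v ≡ at (next m i)) ⊎ (u ≡ at (next m i) × v ≡ at i)))
  cycAdj⁻ {u} {v} t with any⁻ _ (zip (b ∷ bs) (bs ++ b ∷ [])) t
  ... | (x , y) , p∈ , h with nth-zip b b (b ∷ bs) (bs ++ b ∷ []) p∈
  ...   | i , i<m , refl , refl = i , i<m , orient (Equivalence.to (T-∨ {does (at i ≟ u) ∧ does (nth b (bs ++ b ∷ []) i ≟ v)}) h)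
    where
    at-next : nth b (bs ++ b ∷ []) i ≡ at (next m i)
    at-next with suc i ℕₚ.≟ m
    ... | yes refl = nth-∷ʳ-last b bs
    ... | no ne    = nth-∷ʳ b bs (ℕₚ.≤-pred (ℕₚ.≤∧≢⇒< i<m ne))
    both : ∀ {u v} → T (does (at i ≟ u) ∧ does (nth b (bs ++ b ∷ []) i ≟ v)) → u ≡ at i × v ≡ at (next m i)
    both {u} {v} h = let p , q = Equivalence.to (T-∧ {does (at i ≟ u)}) h in
      sym (T-does (at i ≟ u) p) , trans (sym (T-does (nth b (bs ++ b ∷ []) i ≟ v) q)) at-next
    orient : T (does (at i ≟ u) ∧ does (nth b (bs ++ b ∷ []) i ≟ v)) ⊎ T (does (at i ≟ v) ∧ does (nth b (bs ++ b ∷ []) i ≟ u)) →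
             (u ≡ at i × v ≡ at (next m i)) ⊎ (u ≡ at (next m i) × v ≡ at i)
    orient (inj₁ h) = inj₁ (both h)
    orient (inj₂ h) = inj₂ (let p , q = both h in q , p)

foldr-⊔-≤ : {A : Set} (f : A → ℕ) (xs : List A) {x : A} → x ∈ xs → f x ≤ foldr _⊔_ 0 (map f xs)
foldr-⊔-≤ f (x ∷ xs) (here refl) = ℕₚ.m≤m⊔n (f x) _
foldr-⊔-≤ f (x ∷ xs) (there x∈)  = ℕₚ.≤-trans (foldr-⊔-≤ f xs x∈) (ℕₚ.m≤n⊔m (f x) _)

foldr-⊔-attained : {A : Set} (f : A → ℕ) (xs : List A) {k : ℕ} → 0 < k → k ≤ foldr _⊔_ 0 (map f xs) → ∃[ x ] k ≤ f x
foldr-⊔-attained f [] 0<k k≤ = ⊥-elim (ℕₚ.<⇒≱ 0<k k≤)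
foldr-⊔-attained f (x ∷ xs) {k} 0<k k≤ with ℕₚ.⊔-sel (f x) (foldr _⊔_ 0 (map f xs))
... | inj₁ eq = x , subst (k ≤_) eq k≤
... | inj₂ eq = foldr-⊔-attained f xs 0<k (subst (k ≤_) eq k≤)

⌊2m+n/2⌋ : ∀ m n → ⌊ m + m + n /2⌋ ≡ m + ⌊ n /2⌋
⌊2m+n/2⌋ zero    n = refl
⌊2m+n/2⌋ (suc m) n = trans (cong (λ k → ⌊ suc (k + n) /2⌋) (ℕₚ.+-suc m m)) (cong suc (⌊2m+n/2⌋ m n))

-- From separation properties to a star edge colouring

module Verification {n : ℕ} {G : Graph n} (isTree : IsTree G) {r : Fin n} (rooting : Rooting G r) (R : RotationSystem G)
  (3≤deg-r : 3 ≤ deg G r) (b : Fin n) (bs : List (Fin n))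
  (leaf : ∀ {x} → x ∈ b ∷ bs → T (isLeaf G x)) (uniq : Unique (b ∷ bs)) (3≤m : 3 ≤ suc (length bs))
  (L : Fin n → Fin n → List ℕ) (L-sym : SymOnEdges (G ∪ᴳ cycAdj (b ∷ bs)) L)
  where

  H : Graph n
  H = G ∪ᴳ cycAdj (b ∷ bs)

  open Rooting rooting
  open TreeFace isTree rooting R using (adj-sym)
  open Neighbours G
  open LeafCycle isTree rooting R 3≤deg-r using (leaf≢root)
  open CyclicList b bs
  open TreeEdges rooting

  pos-at : ∀ {i} → i < m → pos (b ∷ bs) (at i) ≡ i
  pos-at = pos-nth b (b ∷ bs) uniq

  at-injective : ∀ {i j} → i < m → j < m → at i ≡ at j → i ≡ j
  at-injective i<m j<m eq = trans (sym (pos-at i<m)) (trans (cong (pos (b ∷ bs)) eq) (pos-at j<m))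

  at-leaf : ∀ i → Leaf (at i)
  at-leaf i with nth-default b (b ∷ bs) i
  ... | here eq  = leaf (here eq)
  ... | there ∈bs = leaf ∈bs

  at≢root : ∀ i → at i ≢ r
  at≢root i = leaf≢root (at-leaf i)

  edge-at : ∀ i {y} → Adj G (at i) y → edge (at i) y ≡ at i
  edge-at i {y} a = edge-parent (at≢root i) (leaf-nbr (at-leaf i) a (par-adj (at≢root i)))

  edge-par-at : ∀ i → edge (par (at i)) (at i) ≡ at i
  edge-par-at i = edge-child (at≢root i) refl

  tree-H : ∀ {u v} → Adj G u v → Adj H u v
  tree-H {u} {v} t = Equivalence.from (T-∨ {G u v}) (inj₁ t)

  cycAdj-sym : ∀ xs u v → cycAdj xs u v ≡ cycAdj xs v u
  cycAdj-sym xs u v = any-cong (zip xs (drop 1 xs ++ take 1 xs))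
    where
    along : Fin n → Fin n → Fin n × Fin n → Bool
    along u v p = (does (proj₁ p ≟ u) ∧ does (proj₂ p ≟ v)) ∨ (does (proj₁ p ≟ v) ∧ does (proj₂ p ≟ u))
    any-cong : ∀ ps → any (along u v) ps ≡ any (along v u) ps
    any-cong []       = refl
    any-cong (p ∷ ps) = cong₂ _∨_ (∨-comm (does (proj₁ p ≟ u) ∧ does (proj₂ p ≟ v)) _) (any-cong ps)

  H-sym : ∀ {u v} → Adj H u v → Adj H v u
  H-sym {u} {v} = subst T (trans (cong (_∨ cycAdj (b ∷ bs) u v) (proj₁ isTree u v))
                                 (cong (G v u ∨_) (cycAdj-sym (b ∷ bs) u v)))

  -- In `ring≢pendant` the leaves i and `next m i` are the ends of cycle edge i and serve
  -- properness; the two outer leaves serve the trails through a pendant edge and two successive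
  -- cycle edges.
  module _ (col : Fin n → ℕ) (ring : ℕ → ℕ) (Out : Fin n → Fin n → Fin n → Set)
    (tournament : ∀ {u x y} → Adj G u x → Adj G u y → x ≢ y → Out u x y ⊎ Out u y x)
    (tree-proper : ∀ {u x y} → Adj G u x → Adj G u y → x ≢ y → col (edge u x) ≢ col (edge u y))
    (out-clean : ∀ {u x y z} → Adj G u x → Adj G u y → x ≢ y → Out u x y → Adj G x z → z ≢ u → col (edge x z) ≢ col (edge u y))
    (pendants-differ : ∀ {i} → i < m → col (at i) ≢ col (at (next m i)))
    (ring-star : CycleStar m ring)
    (ring≢pendant : ∀ i {j} → j ∈ prev m i ∷ i ∷ next m i ∷ next m (next m i) ∷ [] → ring i ≢ col (at j))
    (ring≢out : ∀ i {w y} → w ≡ par (at i) → Adj G w y → Out w (at i) y → ring i ≢ col (edge w y))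
    (ring≢out-next : ∀ i {w y} → w ≡ par (at (next m i)) → Adj G w y → Out w (at (next m i)) y → ring i ≢ col (edge w y))
    (col∈ : ∀ {v} → v ≢ r → col v ∈ L v (par v))
    (ring∈ : ∀ {i} → Adj H (at i) (at (next m i)) → ring i ∈ L (at i) (at (next m i)))
    where

    ring-proper : ∀ {i} → i < m → ring i ≢ ring (next m i)
    ring-proper = proj₁ ring-star

    ring-windows : ∀ {i} → i < m → ring i ≡ ring (next m (next m i)) → ring (next m i) ≢ ring (next m (next m (next m i)))
    ring-windows = proj₂ ring-star

    -- The colour is an index, so that matching on an edge reveals its colour together with its
    -- direction along the cycle.
    data Joined (u v : Fin n) : ℕ → Set where
      inTree   : Adj G u v → Joined u v (col (edge u v))
      forward  : ∀ i → i < m → u ≡ at i → v ≡ at (next m i) → Joined u v (ring i)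
      backward : ∀ i → i < m → u ≡ at (next m i) → v ≡ at i → Joined u v (ring i)

    joined-sym : ∀ {u v k} → Joined u v k → Joined v u k
    joined-sym {u} {v} (inTree a)   = subst (Joined v u) (cong col (edge-sym (adj-sym a))) (inTree (adj-sym a))
    joined-sym (forward i p q s)  = backward i p s q
    joined-sym (backward i p q s) = forward i p s q

    -- Orders the constructors: by symmetry two edges at w need to be considered in one order only.
    kind : ∀ {u v k} → Joined u v k → ℕ
    kind (inTree _)         = 0
    kind (forward _ _ _ _)  = 1
    kind (backward _ _ _ _) = 2

    ordered-proper : ∀ {w x y k k′} (p : Joined w x k) (q : Joined w y k′) → kind p ≤ kind q → x ≢ y → k ≢ k′
    ordered-proper (inTree a) (inTree a′) _ x≢y = tree-proper a a′ x≢y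
    ordered-proper (inTree a) (forward i i<m refl refl) _ _ eq =
      ring≢pendant i (there (here refl)) (trans (sym eq) (cong col (edge-at i a)))
    ordered-proper (inTree a) (backward i i<m refl refl) _ _ eq =
      ring≢pendant i (there (there (here refl))) (trans (sym eq) (cong col (edge-at (next m i) a)))
    ordered-proper (forward i i<m refl refl) (forward j j<m p refl) _ x≢y _ = x≢y (cong (at ∘ next m) (at-injective i<m j<m p))
    ordered-proper (forward i i<m refl refl) (backward j j<m p refl) _ _ eq =
      ring-proper j<m (trans (sym eq) (cong ring (at-injective i<m (next-< j<m) p)))
    ordered-proper (backward i i<m refl refl) (backward j j<m p refl) _ x≢y _ =
      x≢y (cong at (next-injective i<m j<m (at-injective (next-< i<m) (next-< j<m) p)))
    ordered-proper (forward _ _ _ _)  (inTree _)        ()       _ _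
    ordered-proper (backward _ _ _ _) (inTree _)        ()       _ _
    ordered-proper (backward _ _ _ _) (forward _ _ _ _) (s≤s ()) _ _

    joined-proper : ∀ {w x y k k′} → Joined w x k → Joined w y k′ → x ≢ y → k ≢ k′
    joined-proper p q x≢y with ℕₚ.≤-total (kind p) (kind q)
    ... | inj₁ le = ordered-proper p q le x≢y
    ... | inj₂ ge = ≢-sym (ordered-proper q p ge (≢-sym x≢y))

    joined-clean : ∀ {w x y z k} → Adj G w x → Adj G w y → x ≢ y → Out w x y → Joined x z k → z ≢ w → k ≢ col (edge w y)
    joined-clean ax ay x≢y o (inTree az) z≢w = out-clean ax ay x≢y o az z≢w
    joined-clean ax ay x≢y o (forward i i<m refl refl) _ =
      ring≢out i (leaf-nbr (at-leaf i) (adj-sym ax) (par-adj (at≢root i))) ay o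
    joined-clean ax ay x≢y o (backward i i<m refl refl) _ =
      ring≢out-next i (leaf-nbr (at-leaf (next m i)) (adj-sym ax) (par-adj (at≢root (next m i)))) ay o

    next-edges : ∀ {i z k} → i < m → Joined (at (next m i)) z k → z ≢ at i → k ≡ col (at (next m i)) ⊎ k ≡ ring (next m i)
    next-edges {i} i<m (inTree a) _ = inj₁ (cong col (edge-at (next m i) a))
    next-edges i<m (forward j j<m p refl) _ = inj₂ (cong ring (at-injective j<m (next-< i<m) (sym p)))
    next-edges i<m (backward j j<m p refl) z≢ =
      ⊥-elim (z≢ (cong at (next-injective j<m i<m (at-injective (next-< j<m) (next-< i<m) (sym p)))))

    prev-edges : ∀ {i z k} → i < m → Joined (at i) z k → z ≢ at (next m i) →
                 k ≡ col (at i) ⊎ ∃[ j ] (j < m × i ≡ next m j × k ≡ ring j)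
    prev-edges {i} i<m (inTree a) _ = inj₁ (cong col (edge-at i a))
    prev-edges i<m (forward j j<m p refl) z≢ = ⊥-elim (z≢ (cong (at ∘ next m) (at-injective j<m i<m (sym p))))
    prev-edges i<m (backward j j<m p refl) _ = inj₂ (j , j<m , at-injective i<m (next-< j<m) p , refl)

    -- The trail is a x w y b. Two tree edges at w are settled by the tournament. With one tree edge
    -- at w, w is a leaf, and k₂ ≡ k₄ contradicts `pendants-differ` or `ring≢pendant`. With two
    -- cycle edges at w, either an outer edge is pendant and `ring≢pendant` applies, or all four
    -- edges lie on the cycle.
    ordered-bichromatic : ∀ {a x w y b k₁ k₂ k₃ k₄} (p : Joined w x k₂) (q : Joined w y k₃) → kind p ≤ kind q →
      x ≢ y → a ≢ w → b ≢ w → Joined x a k₁ → Joined y b k₄ → k₁ ≡ k₃ → k₂ ≡ k₄ → ⊥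
    ordered-bichromatic (inTree ax) (inTree ay) _ x≢y a≢w b≢w e₁ e₄ refl refl with tournament ax ay x≢y
    ... | inj₁ o = joined-clean ax ay x≢y o e₁ a≢w refl
    ... | inj₂ o = joined-clean ay ax (≢-sym x≢y) o e₄ b≢w refl
    ordered-bichromatic (inTree ax) (forward i i<m refl refl) _ x≢y a≢w b≢w e₁ e₄ _ eq with next-edges i<m e₄ b≢w
    ... | inj₁ p = pendants-differ i<m (trans (sym (cong col (edge-at i ax))) (trans eq p))
    ... | inj₂ p = ring≢pendant (next m i) (here refl) (trans (sym p) (trans (sym eq) (trans (cong col (edge-at i ax))
                     (cong (col ∘ at) (sym (prev-next i<m))))))
    ordered-bichromatic (inTree ax) (backward i i<m refl refl) _ x≢y a≢w b≢w e₁ e₄ _ eq with prev-edges i<m e₄ b≢w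
    ... | inj₁ p = pendants-differ i<m (trans (sym p) (trans (sym eq) (cong col (edge-at (next m i) ax))))
    ... | inj₂ (j , j<m , refl , p) = ring≢pendant j (there (there (there (here refl))))
                     (trans (sym p) (trans (sym eq) (cong col (edge-at (next m (next m j)) ax))))
    ordered-bichromatic (forward i i<m refl refl) (forward j j<m p refl) _ x≢y a≢w b≢w e₁ _ _ _ =
      x≢y (cong (at ∘ next m) (at-injective i<m j<m p))
    ordered-bichromatic (backward i i<m refl refl) (backward j j<m p refl) _ x≢y a≢w b≢w e₁ _ _ _ =
      x≢y (cong at (next-injective i<m j<m (at-injective (next-< i<m) (next-< j<m) p)))
    ordered-bichromatic (forward i i<m refl refl) (backward j j<m p refl) _ x≢y a≢w b≢w e₁ e₄ eq eq′
      with at-injective i<m (next-< j<m) p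
    ... | refl with next-edges i<m e₁ a≢w | prev-edges j<m e₄ b≢w
    ...   | inj₁ q | _ = ring≢pendant j (there (there (there (here refl)))) (trans (sym eq) q)
    ...   | inj₂ q | inj₁ s = ring≢pendant (next m j) (here refl) (trans eq′ (trans s (cong (col ∘ at) (sym (prev-next j<m)))))
    ...   | inj₂ q | inj₂ (l , l<m , refl , s) = ring-windows l<m (trans (sym s) (sym eq′)) (trans (sym eq) q)
    ordered-bichromatic (forward _ _ _ _)  (inTree _)        ()       _ _ _ _ _ _ _
    ordered-bichromatic (backward _ _ _ _) (inTree _)        ()       _ _ _ _ _ _ _
    ordered-bichromatic (backward _ _ _ _) (forward _ _ _ _) (s≤s ()) _ _ _ _ _ _ _

    no-bichromatic : ∀ {a x w y b k₁ k₂ k₃ k₄} → x ≢ y → a ≢ w → b ≢ w →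
      Joined x a k₁ → Joined w x k₂ → Joined w y k₃ → Joined y b k₄ → k₁ ≡ k₃ → k₂ ≡ k₄ → ⊥
    no-bichromatic x≢y a≢w b≢w e₁ e₂ e₃ e₄ eq eq′ with ℕₚ.≤-total (kind e₂) (kind e₃)
    ... | inj₁ le = ordered-bichromatic e₂ e₃ le x≢y a≢w b≢w e₁ e₄ eq eq′
    ... | inj₂ ge = ordered-bichromatic e₃ e₂ ge (≢-sym x≢y) b≢w a≢w e₄ e₁ (sym eq′) (sym eq)

    -- A cycle edge is numbered by the end from which `next` leads to the other; for m ≥ 3 this is
    -- so for one end only.
    cycleIndex : Fin n → Fin n → ℕ
    cycleIndex u v with next m (pos (b ∷ bs) u) ℕₚ.≟ pos (b ∷ bs) v
    ... | yes _ = pos (b ∷ bs) u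
    ... | no  _ = pos (b ∷ bs) v

    cycleIndex-forward : ∀ {i} → i < m → cycleIndex (at i) (at (next m i)) ≡ i
    cycleIndex-forward {i} i<m with next m (pos (b ∷ bs) (at i)) ℕₚ.≟ pos (b ∷ bs) (at (next m i))
    ... | yes _ = pos-at i<m
    ... | no ne = ⊥-elim (ne (trans (cong (next m) (pos-at i<m)) (sym (pos-at (next-< i<m)))))

    cycleIndex-backward : ∀ {i} → i < m → cycleIndex (at (next m i)) (at i) ≡ i
    cycleIndex-backward {i} i<m with next m (pos (b ∷ bs) (at (next m i))) ℕₚ.≟ pos (b ∷ bs) (at i)
    ... | yes eq = ⊥-elim (next-next≢ 3≤m i<m (trans (cong (next m) (sym (pos-at (next-< i<m)))) (trans eq (pos-at i<m))))
    ... | no _   = pos-at i<m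

    φ : Fin n → Fin n → ℕ
    φ u v with T? (G u v)
    ... | yes _ = col (edge u v)
    ... | no  _ = ring (cycleIndex u v)

    φ-joined : ∀ {u v} → Adj H u v → Joined u v (φ u v)
    φ-joined {u} {v} a with T? (G u v)
    ... | yes t = inTree t
    ... | no ¬t with Equivalence.to (T-∨ {G u v}) a
    ...   | inj₁ t = ⊥-elim (¬t t)
    ...   | inj₂ t with cycAdj⁻ t
    ...     | i , i<m , inj₁ (refl , refl) = subst (Joined (at i) (at (next m i)) ∘ ring) (sym (cycleIndex-forward i<m)) (forward i i<m refl refl)
    ...     | i , i<m , inj₂ (refl , refl) = subst (Joined (at (next m i)) (at i) ∘ ring) (sym (cycleIndex-backward i<m)) (backward i i<m refl refl)

    φ-sym : SymOnEdges H φ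
    φ-sym u v a with T? (G u v) | T? (G v u)
    ... | yes t | yes _ = cong col (edge-sym t)
    ... | yes t | no ¬t = ⊥-elim (¬t (adj-sym t))
    ... | no ¬t | yes t = ⊥-elim (¬t (adj-sym t))
    ... | no ¬t | no _ with Equivalence.to (T-∨ {G u v}) a
    ...   | inj₁ t = ⊥-elim (¬t t)
    ...   | inj₂ t with cycAdj⁻ t
    ...     | i , i<m , inj₁ (refl , refl) = cong ring (trans (cycleIndex-forward i<m) (sym (cycleIndex-backward i<m)))
    ...     | i , i<m , inj₂ (refl , refl) = cong ring (trans (cycleIndex-backward i<m) (sym (cycleIndex-forward i<m)))

    joined-listed : ∀ {u v k} → Adj H u v → Joined u v k → k ∈ L u v
    joined-listed {u} {v} a (inTree t) with edge-par t
    ... | inj₂ (u≢r , refl) = subst (_∈ L u v) (cong col (sym (edge-parent u≢r refl))) (col∈ u≢r)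
    ... | inj₁ (v≢r , refl) = subst (_∈ L u v) (cong col (sym (edge-child v≢r refl)))
            (subst (col v ∈_) (sym (L-sym u v a)) (col∈ v≢r))
    joined-listed a (forward i i<m refl refl)  = ring∈ a
    joined-listed a (backward i i<m refl refl) = subst (ring i ∈_) (sym (L-sym _ _ a)) (ring∈ (H-sym a))

    two-coloured : ∀ {x y a b c : ℕ} → a ≡ x ⊎ a ≡ y → b ≡ x ⊎ b ≡ y → c ≡ x ⊎ c ≡ y → a ≢ b → b ≢ c → a ≡ c
    two-coloured (inj₁ refl) (inj₁ refl) _ a≢b _ = ⊥-elim (a≢b refl)
    two-coloured (inj₂ refl) (inj₂ refl) _ a≢b _ = ⊥-elim (a≢b refl)
    two-coloured _ (inj₁ refl) (inj₁ refl) _ b≢c = ⊥-elim (b≢c refl)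
    two-coloured _ (inj₂ refl) (inj₂ refl) _ b≢c = ⊥-elim (b≢c refl)
    two-coloured (inj₁ refl) (inj₂ _) (inj₁ refl) _ _ = refl
    two-coloured (inj₂ refl) (inj₁ _) (inj₂ refl) _ _ = refl

    φ-proper : Proper H φ
    φ-proper u v w a a′ u≢w = joined-proper (joined-sym (φ-joined a)) (φ-joined a′) u≢w

    -- Only vertices two apart are asked to differ, so v4 may equal v0 and 4-cycles are covered
    -- along with paths.
    trail : ∀ {v0 v1 v2 v3 v4} → v0 ≢ v2 → v1 ≢ v3 → v2 ≢ v4 →
            Adj H v0 v1 → Adj H v1 v2 → Adj H v2 v3 → Adj H v3 v4 → ¬ Bichromatic H (φ v0 v1) (φ v1 v2) (φ v2 v3) (φ v3 v4)
    trail n02 n13 n24 a b c d (x , y , p , q , s , t) =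
      no-bichromatic n13 n02 (≢-sym n24)
        (joined-sym (φ-joined a)) (joined-sym (φ-joined b)) (φ-joined c) (φ-joined d)
        (two-coloured p q s (φ-proper _ _ _ a b n02) (φ-proper _ _ _ b c n13))
        (two-coloured q s t (φ-proper _ _ _ b c n13) (φ-proper _ _ _ c d n24))

    no-path : NoBichromaticPath4 H φ
    no-path v0 v1 v2 v3 v4 ((_ ∷ n02 ∷ _) ∷ (_ ∷ n13 ∷ _) ∷ (_ ∷ n24 ∷ _) ∷ _) = trail n02 n13 n24

    no-cycle : NoBichromaticCycle4 H φ
    no-cycle v0 v1 v2 v3 ((_ ∷ n02 ∷ _) ∷ (_ ∷ n13 ∷ _) ∷ _) = trail n02 n13 (≢-sym n02)

    colouring : ∃[ ψ ] (IsStarEdgeColoring H ψ × (∀ u v → Adj H u v → ψ u v ∈ L u v))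
    colouring = φ , (φ-sym , φ-proper , no-path , no-cycle) , λ u v a → joined-listed a (φ-joined a)

-- Special vertices and the assembly of the colouring

module SpecialVertices {n : ℕ} {G : Graph n} (isTree : IsTree G) {r : Fin n} (rooting : Rooting G r)
  (R : RotationSystem G) (3≤deg-r : 3 ≤ deg G r) where

  open Rooting rooting
  open RotationLemmas R
  open TreeFace isTree rooting R using (child-or-parent)
  open LeafCycle isTree rooting R 3≤deg-r using (First; Last)

  special? : ∀ z → Dec (First z ⊎ Last z)
  special? z = (¬? (z ≟ r) ×-dec (¬? (par z ≟ r) ×-dec (rot R (par z) (par (par z)) ≟ z)))
          ⊎-dec (¬? (z ≟ r) ×-dec (¬? (par z ≟ r) ×-dec (rot R (par z) z ≟ par (par z))))

  special : Fin n → Bool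
  special z = does (special? z)

  special⁺ : ∀ {z} → First z ⊎ Last z → special z ≡ true
  special⁺ {z} p = dec-true (special? z) p

  special⁻ : ∀ {z} → special z ≡ true → First z ⊎ Last z
  special⁻ {z} eq = T-does (special? z) (subst T (sym eq) tt)

  -- One rotation turns `par u` into the first child, the first child into its successor, and the
  -- last child into `par u`. So the rotated list has only three possible values, and rotation is
  -- injective.
  few-special : ∀ {u xs} → Unique xs → (∀ {x} → x ∈ xs → Adj G u x × (x ≡ par u ⊎ special x ≡ true)) → length xs ≤ 3
  few-special {u} {xs} uniq-xs kind = subst (_≤ 3) (length-map (rot R u) xs)
    (unique-⊆-length {ys = rot R u (par u) ∷ rot R u (rot R u (par u)) ∷ par u ∷ []}
      (unique-map (λ x∈ y∈ → rot-injective (proj₁ (kind x∈)) (proj₁ (kind y∈))) uniq-xs) rotated)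
    where
    rotated : ∀ {y} → y ∈ map (rot R u) xs → y ∈ rot R u (par u) ∷ rot R u (rot R u (par u)) ∷ par u ∷ []
    rotated y∈ with ∈-map⁻ (rot R u) y∈
    ... | x , x∈ , refl with x ≟ par u
    ...   | yes refl = here refl
    ...   | no x≢ with kind x∈
    ...     | _ , inj₁ eq = ⊥-elim (x≢ eq)
    ...     | a , inj₂ sp with child-or-parent a x≢ | special⁻ sp
    ...       | _ , refl | inj₁ (_ , _ , first) = there (here (cong (rot R u) (sym first)))
    ...       | _ , refl | inj₂ (_ , _ , last)  = there (there (here last))

module StarColouring {n : ℕ} {G : Graph n} (isTree : IsTree G) {r : Fin n} (rooting : Rooting G r)
  (R : RotationSystem G) (3≤deg-r : 3 ≤ deg G r)
  (b : Fin n) (bs : List (Fin n))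
  (leaf : ∀ {x} → x ∈ b ∷ bs → T (isLeaf G x)) (uniq : Unique (b ∷ bs))
  (3≤m : 3 ≤ suc (length bs)) (m≢5 : suc (length bs) ≢ 5)
  (consecutive : ∀ {i} → i < suc (length bs) →
     LeafCycle.Next isTree rooting R 3≤deg-r (nth b (b ∷ bs) i) (nth b (b ∷ bs) (next (suc (length bs)) i)))
  (special : Fin n → Bool)
  (special⁺ : ∀ {z} → LeafCycle.First isTree rooting R 3≤deg-r z ⊎ LeafCycle.Last isTree rooting R 3≤deg-r z → special z ≡ true)
  (few-special : ∀ {u xs} → Unique xs → (∀ {x} → x ∈ xs → Adj G u x × (x ≡ Rooting.par rooting u ⊎ special x ≡ true)) →
     length xs ≤ 3)
  (K : ℕ)
  (edge-bound : ∀ {u w} → Adj G u w → ⌊ deg G u /2⌋ + deg G w ≤ K)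
  (deg-bound : ∀ u → deg G u + 6 ≤ K)
  (half-bound : ∀ u w → ⌊ deg G u /2⌋ + ⌊ deg G w /2⌋ + 7 ≤ K)
  (L : Fin n → Fin n → List ℕ) (valid : ValidListAssignment (G ∪ᴳ cycAdj (b ∷ bs)) K L)
  where

  open Rooting rooting
  open TreeFace isTree rooting R using (adj-sym)
  open Neighbours G
  open LeafCycle isTree rooting R 3≤deg-r using (First; Last; Next; siblings; descending; ascending; crossing)
  open CyclicList b bs
  open TreeEdges rooting
  open Verification isTree rooting R 3≤deg-r b bs leaf uniq 3≤m L (proj₁ valid) hiding (colouring)
  module Scheme = CycleScheme (cycleScheme 3≤m m≢5)

  -- Inner vertices may be special too; for them `pos` returns m, and the entries are two leaves
  -- that merely add conflicts.
  near : Fin n → List (Fin n)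
  near v = at (next m (pos (b ∷ bs) v)) ∷ at (prev m (pos (b ∷ bs) v)) ∷ []

  open TreeConflicts isTree rooting R special near (λ _ → ℕₚ.≤-refl) few-special K edge-bound deg-bound
  open DepthRank depth special
  open Tournament G rank rank-injective

  -- upTo K is a dummy: greedy colouring also treats the root and the indices beyond the cycle, which name no edge
  lists : Fin n → Fin n → List ℕ
  lists u v with T? (H u v)
  ... | yes _ = L u v
  ... | no  _ = upTo K

  unique-lists : ∀ u v → Unique (lists u v)
  unique-lists u v with T? (H u v)
  ... | yes a = proj₁ (proj₂ valid u v a)
  ... | no  _ = Uniq.upTo⁺ K

  long-lists : ∀ u v → K ≤ length (lists u v)
  long-lists u v with T? (H u v)
  ... | yes a = proj₂ (proj₂ valid u v a)
  ... | no  _ = ℕₚ.≤-reflexive (sym (length-upTo K))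

  lists-∈ : ∀ {u v k} → Adj H u v → k ∈ lists u v → k ∈ L u v
  lists-∈ {u} {v} a k∈ with T? (H u v)
  ... | yes _ = k∈
  ... | no ¬a = ⊥-elim (¬a a)

  next-near : ∀ {i} → i < m → at (next m i) ∈ near (at i)
  next-near {i} i<m = here (cong (at ∘ next m) (sym (pos-at i<m)))

  prev-near : ∀ {i} → i < m → at i ∈ near (at (next m i))
  prev-near {i} i<m = there (here (cong at (trans (sym (prev-next i<m)) (cong (prev m) (sym (pos-at (next-< i<m)))))))

  TreeColouring : Set
  TreeColouring = Σ (Fin n → ℕ) λ col → ((∀ v → col v ∈ lists v (par v)) × (∀ v {x} → x ∈ [] → col v ≢ x) ×
                            (∀ v w → w ∈ conf v → rank w < rank v → col v ≢ col w))

  treeColouring : TreeColouring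
  treeColouring = Greedy.colouring rank conf (λ _ → []) (λ v → lists v (par v)) (λ v → unique-lists v (par v))
    (λ v → ℕₚ.≤-<-trans (length-filter (λ j → rank j <? rank v) (conf v)) (ℕₚ.<-≤-trans (length-conf v) (long-lists v (par v))))

  module Ring (col : Fin n → ℕ) (col-differs : ∀ v w → w ∈ conf v → rank w < rank v → col v ≢ col w) where

    open Coloured col col-differs renaming (proper to tree-proper)

    pendants-differ : ∀ {i} → i < m → col (at i) ≢ col (at (next m i))
    pendants-differ {i} i<m with par (at i) ≟ par (at (next m i))
    ... | yes p = λ eq → tree-proper {par (at i)} {at i} {at (next m i)}
            (adj-sym (par-adj (at≢root i)))
            (subst (λ w → Adj G w (at (next m i))) (sym p) (adj-sym (par-adj (at≢root (next m i)))))
            at≢ (trans (cong col (edge-par-at i)) (trans eq (cong col (sym (edge-child (at≢root (next m i)) p)))))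
      where
      at≢ : at i ≢ at (next m i)
      at≢ eq = next-next≢ 3≤m i<m (trans (cong (next m) (sym fixed)) (sym fixed))
        where
        fixed : i ≡ next m i
        fixed = at-injective i<m (next-< i<m) eq
    ... | no ¬p = by-next (consecutive i<m)
      where
      later : First (at (next m i)) → rank (at i) < rank (at (next m i)) → col (at i) ≢ col (at (next m i))
      later f lt = ≢-sym (near-differ (at≢root (next m i)) (special⁺ (inj₁ f)) (prev-near i<m) lt)
      earlier : Last (at i) → rank (at (next m i)) < rank (at i) → col (at i) ≢ col (at (next m i))
      earlier l lt = near-differ (at≢root i) (special⁺ (inj₂ l)) (next-near i<m) lt
      by-next : Next (at i) (at (next m i)) → col (at i) ≢ col (at (next m i))
      by-next (siblings p)      = ⊥-elim (¬p p)
      by-next (descending lt f) = later f (rank-depth lt)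
      by-next (ascending lt l)  = earlier l (rank-depth lt)
      -- Both leaves are special, so whichever is coloured later avoids the other.
      by-next (crossing l f) with ℕₚ.<-cmp (rank (at i)) (rank (at (next m i)))
      ... | tri< lt _ _ = later f lt
      ... | tri≈ _ eq _ = ⊥-elim (¬p (cong par (rank-injective eq)))
      ... | tri> _ _ lt = earlier l lt

    leafOut : ℕ → List ℕ
    leafOut i = map (col ∘ edge (par (at i))) (out (par (at i)) (at i))

    avoid : ℕ → List ℕ
    avoid i = leafOut i ++ (leafOut (next m i) ++
              map (col ∘ at) (prev m i ∷ i ∷ next m i ∷ next m (next m i) ∷ []))

    -- Two `out` lists, four pendant edges and two conflicts on the cycle are forbidden; one further
    -- colour makes the 7 of `half-bound`.
    enough : ∀ i → length (avoid i) + length (filter (λ j → Scheme.rank j <? Scheme.rank i) (Scheme.conf i)) < length (lists (at i) (at (next m i)))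
    enough i = begin-strict
      length (avoid i) + length (filter (λ j → Scheme.rank j <? Scheme.rank i) (Scheme.conf i))
        ≤⟨ ℕₚ.+-mono-≤ (ℕₚ.≤-reflexive (trans (length-++ (leafOut i)) (cong (length (leafOut i) +_) (length-++ (leafOut (next m i))))))
             (ℕₚ.≤-trans (length-filter _ (Scheme.conf i)) (Scheme.two i)) ⟩
      length (leafOut i) + (length (leafOut (next m i)) + 4) + 2
        ≤⟨ ℕₚ.+-monoˡ-≤ 2 (ℕₚ.+-mono-≤ (short i) (ℕₚ.+-monoˡ-≤ 4 (short (next m i)))) ⟩
      h + (h′ + 4) + 2 ≡⟨ cong (_+ 2) (ℕₚ.+-assoc h h′ 4) ⟨
      h + h′ + 4 + 2   ≡⟨ ℕₚ.+-assoc (h + h′) 4 2 ⟩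
      h + h′ + 6       <⟨ ℕₚ.+-monoʳ-< (h + h′) ℕₚ.≤-refl ⟩
      h + h′ + 7       ≤⟨ half-bound (par (at i)) (par (at (next m i))) ⟩
      K                ≤⟨ long-lists (at i) (at (next m i)) ⟩
      length (lists (at i) (at (next m i))) ∎
      where
      open ℕₚ.≤-Reasoning
      h  = half (par (at i))
      h′ = half (par (at (next m i)))
      short : ∀ j → length (leafOut j) ≤ half (par (at j))
      short j = ℕₚ.≤-trans (ℕₚ.≤-reflexive (length-map _ (out (par (at j)) (at j)))) (length-out (adj-sym (par-adj (at≢root j))))

    RingColouring : Set
    RingColouring = Σ (ℕ → ℕ) λ ring → ((∀ i → ring i ∈ lists (at i) (at (next m i))) × (∀ i {x} → x ∈ avoid i → ring i ≢ x) ×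
                               (∀ i j → j ∈ Scheme.conf i → Scheme.rank j < Scheme.rank i → ring i ≢ ring j))

    ringColouring : RingColouring
    ringColouring = Greedy.colouring Scheme.rank Scheme.conf avoid (λ i → lists (at i) (at (next m i)))
      (λ i → unique-lists (at i) (at (next m i))) enough

    module Avoiding (ring : ℕ → ℕ) (cyc-avoids : ∀ i {x} → x ∈ avoid i → ring i ≢ x) where

      ring≢pendant : ∀ i {j} → j ∈ prev m i ∷ i ∷ next m i ∷ next m (next m i) ∷ [] → ring i ≢ col (at j)
      ring≢pendant i j∈ = cyc-avoids i (∈-++⁺ʳ (leafOut i) (∈-++⁺ʳ (leafOut (next m i)) (∈-map⁺ (col ∘ at) j∈)))

      ring≢out : ∀ i {w y} → w ≡ par (at i) → Adj G w y → Out w (at i) y → ring i ≢ col (edge w y)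
      ring≢out i refl a o = cyc-avoids i (∈-++⁺ˡ (∈-map⁺ (col ∘ edge (par (at i))) (out⁺ a o)))

      ring≢out-next : ∀ i {w y} → w ≡ par (at (next m i)) → Adj G w y → Out w (at (next m i)) y → ring i ≢ col (edge w y)
      ring≢out-next i refl a o = cyc-avoids i (∈-++⁺ʳ (leafOut i) (∈-++⁺ˡ (∈-map⁺ (col ∘ edge (par (at (next m i)))) (out⁺ a o))))

  StarColourable : Set
  StarColourable = ∃[ ψ ] (IsStarEdgeColoring H ψ × (∀ u v → Adj H u v → ψ u v ∈ L u v))

  -- Stated for arbitrary colourings, so that only the specification of the greedy construction
  -- enters.
  combine : ∀ (col : Fin n → ℕ) (col∈ : ∀ v → col v ∈ lists v (par v))
    (col-differs : ∀ v w → w ∈ conf v → rank w < rank v → col v ≢ col w) →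
    Ring.RingColouring col col-differs → StarColourable
  combine col col∈ col-differs (ring , ring∈ , ring-avoids , ring-differs) =
    Verification.colouring isTree rooting R 3≤deg-r b bs leaf uniq 3≤m L (proj₁ valid) col ring Out
      tournament proper out-clean pendants-differ (Scheme.star ring ring-differs)
      ring≢pendant ring≢out ring≢out-next
      (λ {v} v≢r → lists-∈ (tree-H (par-adj v≢r)) (col∈ v))
      (λ {i} a → lists-∈ a (ring∈ i))
    where
    open Coloured col col-differs using (proper; out-clean)
    open Ring col col-differs using (pendants-differ; module Avoiding)
    open Avoiding ring ring-avoids

  complete : TreeColouring → StarColourable
  complete (col , col∈ , _ , col-differs) = combine col col∈ col-differs (Ring.ringColouring col col-differs)

  colouring : StarColourable
  colouring = complete treeColouring

nth-lastOr : {A : Set} (d b : A) (bs : List A) → nth d (b ∷ bs) (length bs) ≡ lastOr b bs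
nth-lastOr d b []       = refl
nth-lastOr d b (c ∷ cs) = nth-lastOr d c cs

linked-cycle : {A : Set} {_∼_ : A → A → Set} {b : A} {bs : List A} → Linked _∼_ (lastOr b bs ∷ b ∷ bs) →
               ∀ {i} → i < suc (length bs) → nth b (b ∷ bs) i ∼ nth b (b ∷ bs) (next (suc (length bs)) i)
linked-cycle {_∼_ = _∼_} {b} {bs} (closing ∷ linked) {i} i<m with suc i ℕₚ.≟ suc (length bs)
... | yes refl = subst (_∼ b) (sym (nth-lastOr b b bs)) closing
... | no ne    = nth-linked b (b ∷ bs) linked (ℕₚ.≤∧≢⇒< i<m ne)

-- Numerical bounds and conclusion

module Bounds {n : ℕ} (G : Graph n) where

  Δ h bound : ℕ
  Δ     = maxDeg G
  h     = ⌊ Δ /2⌋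
  bound = ⌊ theta G + Δ /2⌋ ⊔ (2 * h + 7)

  deg≤Δ : ∀ u → deg G u ≤ Δ
  deg≤Δ u = foldr-⊔-≤ (deg G) (allFin n) (∈-allFin u)

  deg+deg≤θ : ∀ {u w} → Adj G u w → deg G u + deg G w ≤ theta G
  deg+deg≤θ {u} {w} a = subst (_≤ theta G) (if-true (G u w) a)
    (foldr-⊔-≤ (λ p → if G (proj₁ p) (proj₂ p) then deg G (proj₁ p) + deg G (proj₂ p) else 0)
      (cartesianProduct (allFin n) (allFin n)) (∈-cartesianProduct⁺ (∈-allFin u) (∈-allFin w)))
    where
    if-true : ∀ b {x y : ℕ} → T b → (if b then x else y) ≡ x
    if-true true _ = refl

  edge-bound : ∀ {u w} → Adj G u w → ⌊ deg G u /2⌋ + deg G w ≤ bound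
  edge-bound {u} {w} a = begin
    ⌊ deg G u /2⌋ + deg G w           ≡⟨ ℕₚ.+-comm ⌊ deg G u /2⌋ (deg G w) ⟩
    deg G w + ⌊ deg G u /2⌋           ≡⟨ ⌊2m+n/2⌋ (deg G w) (deg G u) ⟨
    ⌊ deg G w + deg G w + deg G u /2⌋ ≡⟨ cong ⌊_/2⌋ (ℕₚ.+-comm (deg G w + deg G w) (deg G u)) ⟩
    ⌊ deg G u + (deg G w + deg G w) /2⌋ ≡⟨ cong ⌊_/2⌋ (ℕₚ.+-assoc (deg G u) (deg G w) (deg G w)) ⟨
    ⌊ deg G u + deg G w + deg G w /2⌋ ≤⟨ ℕₚ.⌊n/2⌋-mono (ℕₚ.+-mono-≤ (deg+deg≤θ a) (deg≤Δ w)) ⟩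
    ⌊ theta G + Δ /2⌋                 ≤⟨ ℕₚ.m≤m⊔n _ _ ⟩
    bound                             ∎
    where open ℕₚ.≤-Reasoning

  2h+7≤bound : h + h + 7 ≤ bound
  2h+7≤bound = ℕₚ.≤-trans (ℕₚ.≤-reflexive (cong (λ k → h + k + 7) (sym (ℕₚ.+-identityʳ h)))) (ℕₚ.m≤n⊔m _ _)

  deg-bound : ∀ u → deg G u + 6 ≤ bound
  deg-bound u = begin
    deg G u + 6       ≤⟨ ℕₚ.+-monoˡ-≤ 6 (ℕₚ.≤-trans (deg≤Δ u) (n≤1+2⌊n/2⌋ Δ)) ⟩
    suc (h + h) + 6   ≡⟨ ℕₚ.+-suc (h + h) 6 ⟨
    h + h + 7         ≤⟨ 2h+7≤bound ⟩
    bound             ∎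
    where open ℕₚ.≤-Reasoning

  half-bound : ∀ u w → ⌊ deg G u /2⌋ + ⌊ deg G w /2⌋ + 7 ≤ bound
  half-bound u w = ℕₚ.≤-trans
    (ℕₚ.+-monoˡ-≤ 7 (ℕₚ.+-mono-≤ (ℕₚ.⌊n/2⌋-mono (deg≤Δ u)) (ℕₚ.⌊n/2⌋-mono (deg≤Δ w)))) 2h+7≤bound

module Choosable {n : ℕ} {G : Graph n} (isTree : IsTree G) {r : Fin n} (3≤deg-r : 3 ≤ deg G r)
  (R : RotationSystem G) {u v : Fin n} (uv : Adj G u v) where

  rooting : Rooting G r
  rooting = TreeRooting.rooting G isTree r

  open Bounds G
  open LeafCycle isTree rooting R 3≤deg-r using (Next; module Boundary)
  open Boundary uv
  open SpecialVertices isTree rooting R 3≤deg-r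

  choosable-list : ∀ {b bs} → leaves ≡ b ∷ bs → Linked Next (lastOr b bs ∷ b ∷ bs) → suc (length bs) ≢ 5 →
                   StarChoosable (G ∪ᴳ cycAdj (b ∷ bs)) bound
  choosable-list {b} {bs} eq linked m≢5 L valid = StarColouring.colouring isTree rooting R 3≤deg-r b bs
    (λ x∈ → leaves-leaf (subst (_ ∈_) (sym eq) x∈)) (subst Unique eq unique-leaves)
    (subst (λ xs → 3 ≤ length xs) eq three-leaves) m≢5 (linked-cycle linked)
    special special⁺ few-special bound edge-bound deg-bound half-bound L valid

  choosable : length leaves ≢ 5 → StarChoosable (G ∪ᴳ cycAdj leaves) bound
  choosable m≢5 = from cyclic-next
    where
    from : ∃[ b ] ∃[ bs ] (leaves ≡ b ∷ bs × Linked Next (lastOr b bs ∷ b ∷ bs)) →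
           StarChoosable (G ∪ᴳ cycAdj leaves) bound
    from (b , bs , eq , linked) = subst (λ xs → StarChoosable (G ∪ᴳ cycAdj xs) bound) (sym eq)
      (choosable-list eq linked (m≢5 ∘ trans (cong length eq)))

theorem11 : ∀ {n : ℕ} (H : GenHalin n) → length (cyc H) ≢ 5 →
    ListStarChromaticIndex≤ (graph H)
    (⌊ theta (tree H) + maxDeg (tree H) /2⌋ ⊔ (2 * ⌊ maxDeg (tree H) /2⌋ + 7))
theorem11 {n} H m≢5 = bound , ℕₚ.≤-refl , choose (embedded H) (foldr-⊔-attained (deg (tree H)) (allFin n) (s≤s z≤n) (Δ≥3 H))
  where
  open Bounds (tree H)
  choose : PlaneLeafOrder (tree H) (cyc H) → ∃[ r ] 3 ≤ deg (tree H) r → StarChoosable (graph H) bound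
  choose (R , u , v , uv , leafOrder≡cyc) (r , 3≤deg-r) =
    subst (λ xs → StarChoosable (tree H ∪ᴳ cycAdj xs) bound) leaves≡cyc
      (choosable (m≢5 ∘ trans (cong length (sym leaves≡cyc))))
    where
    open Choosable (isTree H) 3≤deg-r R uv
    open LeafCycle.Boundary (isTree H) rooting R 3≤deg-r uv
    leaves≡cyc : leaves ≡ cyc H
    leaves≡cyc = trans (sym leafOrder≡) leafOrder≡cyc
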